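{- There exist constants $\varepsilon,\delta>0$ such that every (randomized) $(1-\varepsilon)$-approximation algorithm for the max ones problem has Lipschitz constant $\Omega(n^{\delta})$, where $n$ is the number of variables; i.e., there are instances with $n$ variables (for infinitely many/all large $n$) on which the Lipschitz constant of the algorithm, with respect to changes of the weight function for the fixed 3CNF formula, is at least $c\,n^{\delta}$ for a constant $c>0$.
   Context: Max ones problem: an instance is a 3CNF formula $\Phi$ over a variable set $X$ and a weight function $w:X\to\mathbb{R}_{\ge0}$; a solution is a satisfying assignment $\sigma:X\to\{0,1\}$, identified with the set $\sigma^{ -1}(1)$, and the objective is to maximize $w(\sigma^{ -1}(1))=\sum_{x\in\sigma^{ -1}(1)}w(x)$. A $(1-\varepsilon)$-approximation algorithm always outputs a satisfying assignment whose expected weight is at least $(1-\varepsilon)$ times the optimum. Weighted Hamming distance: for $A,A'\subseteq X$ and $w,w'$, $d_{\mathrm w}((A,w),(A',w'))=\sum_{x\in A\cap A'}|w(x)-w'(x)|+\sum_{x\in A\setminus A'}w(x)+\sum_{x\in A'\setminus A}w'(x)$; $\mathrm{EM}$ is the infimum over couplings of the output distributions of the expected $d_{\mathrm w}$. The Lipschitz constant of algorithm $\mathcal A$ on formula $\Phi$ is $\sup_{w\neq w'}\mathrm{EM}((\mathcal A(\Phi,w),w),(\mathcal A(\Phi,w'),w'))/\|w-w'\|_1$, with $\mathcal A(\Phi,w)$ the distribution of $\sigma^{ -1}(1)$. -}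

module Defs where

open import Algebra.Bundles.Raw using (RawMonoid)
open import Data.Bool.Base using (Bool; if_then_else_)
open import Data.Fin.Base using (Fin)
open import Data.Fin.Subset using (Subset; inside; outside; _∩_; _─_)
open import Data.Integer.Base as ℤ using (+_; +[1+_])
import Data.Integer.Properties as ℤP
open import Data.List.Base using (List)
open import Data.List.Relation.Unary.All using (All)
open import Data.Nat.Base as ℕ using (ℕ; zero; suc)
import Data.Nat.Properties as ℕP
import Data.Nat.Tactic.RingSolver as ℕSolver
open import Data.Product.Base using (_×_; _,_; ∃-syntax; proj₁; proj₂)
open import Data.Rational.Base as ℚ using (ℚ; mkℚ; 0ℚ; 1ℚ)
import Data.Rational.Properties as ℚP
import Data.Rational.Unnormalised.Base as ℚᵘ
import Data.Rational.Unnormalised.Properties as ℚᵘP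
open import Data.Rational.Solver using (module +-*-Solver)
open import Data.Sum.Base using (inj₁; inj₂)
open import Data.Vec.Base using (Vec; []; _∷_; lookup)
open import Data.Vec.Relation.Unary.Any using (Any)
open import Level using (0ℓ)
open import Relation.Binary.PropositionalEquality
open import Relation.Nullary using (¬_; yes; no; contradiction)

-- Real numbers: Cauchy sequences of rationals, taken up to _≈_.

IsCauchy : (ℕ → ℚ) → Set
IsCauchy s = ∀ η → 0ℚ ℚ.< η → ∃[ N ] (∀ m n → N ℕ.≤ m → N ℕ.≤ n →
  ℚ.∣ s m ℚ.- s n ∣ ℚ.≤ η)

record ℝ : Set where
  constructor mkℝ
  field
    seq    : ℕ → ℚ
    cauchy : IsCauchy seq

open ℝ public

infix 4 _≤_ _<_ _≈_

_≤_ : ℝ → ℝ → Set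
x ≤ y = ∀ η → 0ℚ ℚ.< η → ∃[ N ] (∀ n → N ℕ.≤ n → seq x n ℚ.≤ seq y n ℚ.+ η)

_<_ : ℝ → ℝ → Set
x < y = ∃[ η ] (0ℚ ℚ.< η × ∃[ N ] (∀ n → N ℕ.≤ n → seq x n ℚ.+ η ℚ.≤ seq y n))

_≈_ : ℝ → ℝ → Set
x ≈ y = x ≤ y × y ≤ x

module CauchyLemmas where
  half : ∀ η → 0ℚ ℚ.< η → 0ℚ ℚ.< ℚ.½ ℚ.* η
  half η η>0 = ℚP.positive⁻¹ (ℚ.½ ℚ.* η)
    {{ℚP.pos*pos⇒pos ℚ.½ η {{ℚ.positive η>0}}}}

  half+half : ∀ η → ℚ.½ ℚ.* η ℚ.+ ℚ.½ ℚ.* η ≡ η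
  half+half η = trans (sym (ℚP.*-distribʳ-+ η ℚ.½ ℚ.½)) (ℚP.*-identityˡ η)

  +-split : ∀ a b a′ b′ → (a ℚ.+ b) ℚ.- (a′ ℚ.+ b′) ≡ (a ℚ.- a′) ℚ.+ (b ℚ.- b′)
  +-split = solve 4 (λ a b a′ b′ →
    (a :+ b) :- (a′ :+ b′) := (a :- a′) :+ (b :- b′)) refl
    where open +-*-Solver

  *-split : ∀ a b a′ b′ →
    a ℚ.* b ℚ.- a′ ℚ.* b′ ≡ a ℚ.* (b ℚ.- b′) ℚ.+ (a ℚ.- a′) ℚ.* b′
  *-split = solve 4 (λ a b a′ b′ →
    a :* b :- a′ :* b′ := a :* (b :- b′) :+ (a :- a′) :* b′) refl
    where open +-*-Solver

  neg-split : ∀ a b → (ℚ.- a) ℚ.- (ℚ.- b) ≡ ℚ.- (a ℚ.- b)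
  neg-split = solve 2 (λ a b → (:- a) :- (:- b) := :- (a :- b)) refl
    where open +-*-Solver

  sub-add : ∀ a b → a ≡ (a ℚ.- b) ℚ.+ b
  sub-add = solve 2 (λ a b → a := (a :- b) :+ b) refl
    where open +-*-Solver

  neg-sub : ∀ a b → ℚ.- (a ℚ.- b) ≡ b ℚ.- a
  neg-sub = solve 2 (λ a b → :- (a :- b) := b :- a) refl
    where open +-*-Solver

  ∣-∣-swap : ∀ a b → ℚ.∣ a ℚ.- b ∣ ≡ ℚ.∣ b ℚ.- a ∣
  ∣-∣-swap a b = trans (sym (ℚP.∣-p∣≡∣p∣ (a ℚ.- b))) (cong ℚ.∣_∣ (neg-sub a b))

  a≤b+c⇒a-b≤c : ∀ {a b c} → a ℚ.≤ b ℚ.+ c → a ℚ.- b ℚ.≤ c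
  a≤b+c⇒a-b≤c {a} {b} {c} p = subst (a ℚ.- b ℚ.≤_)
    (solve 2 (λ b c → (b :+ c) :- b := c) refl b c) (ℚP.+-monoˡ-≤ (ℚ.- b) p)
    where open +-*-Solver

  ∣-∣-bound : ∀ {a b c} → a ℚ.- b ℚ.≤ c → b ℚ.- a ℚ.≤ c → ℚ.∣ a ℚ.- b ∣ ℚ.≤ c
  ∣-∣-bound {a} {b} {c} p q with ℚP.∣p∣≡p∨∣p∣≡-p (a ℚ.- b)
  ... | inj₁ e = subst (ℚ._≤ c) (sym e) p
  ... | inj₂ e = subst (ℚ._≤ c) (sym (trans e (neg-sub a b))) q

  ∣a∣≤∣a-b∣+∣b∣ : ∀ a b → ℚ.∣ a ∣ ℚ.≤ ℚ.∣ b ∣ ℚ.+ ℚ.∣ a ℚ.- b ∣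
  ∣a∣≤∣a-b∣+∣b∣ a b = subst₂ ℚ._≤_ (cong ℚ.∣_∣ (sym (sub-add a b)))
    (ℚP.+-comm ℚ.∣ a ℚ.- b ∣ ℚ.∣ b ∣) (ℚP.∣p+q∣≤∣p∣+∣q∣ (a ℚ.- b) b)

  ∣∣-∣∣-bound : ∀ a b → ℚ.∣ ℚ.∣ a ∣ ℚ.- ℚ.∣ b ∣ ∣ ℚ.≤ ℚ.∣ a ℚ.- b ∣
  ∣∣-∣∣-bound a b = ∣-∣-bound {ℚ.∣ a ∣} {ℚ.∣ b ∣}
    (a≤b+c⇒a-b≤c (∣a∣≤∣a-b∣+∣b∣ a b))
    (subst (ℚ.∣ b ∣ ℚ.- ℚ.∣ a ∣ ℚ.≤_) (∣-∣-swap b a)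
      (a≤b+c⇒a-b≤c (∣a∣≤∣a-b∣+∣b∣ b a)))

  ≤⊔ˡ : ∀ {M N n} → M ℕ.⊔ N ℕ.≤ n → M ℕ.≤ n
  ≤⊔ˡ {M} {N} = ℕP.≤-trans (ℕP.m≤m⊔n M N)

  ≤⊔ʳ : ∀ {M N n} → M ℕ.⊔ N ℕ.≤ n → N ℕ.≤ n
  ≤⊔ʳ {M} {N} = ℕP.≤-trans (ℕP.m≤n⊔m M N)

  const-cauchy : ∀ q → IsCauchy (λ _ → q)
  const-cauchy q η η>0 = 0 , λ _ _ _ _ →
    subst (λ z → ℚ.∣ z ∣ ℚ.≤ η) (sym (ℚP.+-inverseʳ q)) (ℚP.<⇒≤ η>0)

  +-cauchy : ∀ {s t} → IsCauchy s → IsCauchy t → IsCauchy (λ n → s n ℚ.+ t n)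
  +-cauchy {s} {t} cs ct η η>0
    with cs (ℚ.½ ℚ.* η) (half η η>0) | ct (ℚ.½ ℚ.* η) (half η η>0)
  ... | M , p | N , q = M ℕ.⊔ N , λ m n M≤m M≤n → begin
    ℚ.∣ (s m ℚ.+ t m) ℚ.- (s n ℚ.+ t n) ∣
      ≡⟨ cong ℚ.∣_∣ (+-split (s m) (t m) (s n) (t n)) ⟩
    ℚ.∣ (s m ℚ.- s n) ℚ.+ (t m ℚ.- t n) ∣
      ≤⟨ ℚP.∣p+q∣≤∣p∣+∣q∣ (s m ℚ.- s n) (t m ℚ.- t n) ⟩
    ℚ.∣ s m ℚ.- s n ∣ ℚ.+ ℚ.∣ t m ℚ.- t n ∣
      ≤⟨ ℚP.+-mono-≤ (p m n (≤⊔ˡ M≤m) (≤⊔ˡ M≤n)) (q m n (≤⊔ʳ M≤m) (≤⊔ʳ M≤n)) ⟩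
    ℚ.½ ℚ.* η ℚ.+ ℚ.½ ℚ.* η
      ≡⟨ half+half η ⟩
    η ∎
    where open ℚP.≤-Reasoning

  neg-cauchy : ∀ {s} → IsCauchy s → IsCauchy (λ n → ℚ.- s n)
  neg-cauchy {s} cs η η>0 with cs η η>0
  ... | N , p = N , λ m n N≤m N≤n → subst (ℚ._≤ η)
    (sym (trans (cong ℚ.∣_∣ (neg-split (s m) (s n))) (ℚP.∣-p∣≡∣p∣ (s m ℚ.- s n))))
    (p m n N≤m N≤n)

  abs-cauchy : ∀ {s} → IsCauchy s → IsCauchy (λ n → ℚ.∣ s n ∣)
  abs-cauchy {s} cs η η>0 with cs η η>0
  ... | N , p = N , λ m n N≤m N≤n →
    ℚP.≤-trans (∣∣-∣∣-bound (s m) (s n)) (p m n N≤m N≤n)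

  0<1 : 0ℚ ℚ.< 1ℚ
  0<1 = ℚP.positive⁻¹ 1ℚ

  eventually-bounded : ∀ {s} → IsCauchy s →
    ∃[ B ] (0ℚ ℚ.< B × ∃[ N ] (∀ n → N ℕ.≤ n → ℚ.∣ s n ∣ ℚ.≤ B))
  eventually-bounded {s} cs with cs 1ℚ 0<1
  ... | N , p = ℚ.∣ s N ∣ ℚ.+ 1ℚ
    , ℚP.+-mono-≤-< (ℚP.0≤∣p∣ (s N)) 0<1
    , N , λ n N≤n → ℚP.≤-trans (∣a∣≤∣a-b∣+∣b∣ (s n) (s N))
        (ℚP.+-monoʳ-≤ ℚ.∣ s N ∣ (p n N N≤n ℕP.≤-refl))

  divide : ∀ D η → 0ℚ ℚ.< D → 0ℚ ℚ.< η → ∃[ ζ ] (0ℚ ℚ.< ζ × D ℚ.* ζ ≡ η)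
  divide D η D>0 η>0 = ℚ.1/ D ℚ.* η
    , ℚP.positive⁻¹ (ℚ.1/ D ℚ.* η)
        {{ℚP.pos*pos⇒pos (ℚ.1/ D) {{ℚP.1/pos⇒pos D}} η {{ℚ.positive η>0}}}}
    , trans (sym (ℚP.*-assoc D (ℚ.1/ D) η))
        (trans (cong (ℚ._* η) (ℚP.*-inverseʳ D)) (ℚP.*-identityˡ η))
    where
    instance
      D-pos : ℚ.Positive D
      D-pos = ℚ.positive D>0

      D-nonZero : ℚ.NonZero D
      D-nonZero = ℚP.pos⇒nonZero D

  mono-* : ∀ {p q r u} → 0ℚ ℚ.≤ p → p ℚ.≤ q → 0ℚ ℚ.≤ u → r ℚ.≤ u →
    p ℚ.* r ℚ.≤ q ℚ.* u
  mono-* {p} {q} {r} {u} 0≤p p≤q 0≤u r≤u = ℚP.≤-trans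
    (ℚP.*-monoˡ-≤-nonNeg p {{ℚ.nonNegative 0≤p}} r≤u)
    (ℚP.*-monoʳ-≤-nonNeg u {{ℚ.nonNegative 0≤u}} p≤q)

  factor : ∀ B ζ C → B ℚ.* ζ ℚ.+ ζ ℚ.* C ≡ (B ℚ.+ C) ℚ.* ζ
  factor = solve 3 (λ B ζ C → B :* ζ :+ ζ :* C := (B :+ C) :* ζ) refl
    where open +-*-Solver

  *-bound : ∀ {a b a′ b′ B C ζ} → 0ℚ ℚ.< C → 0ℚ ℚ.< ζ →
    ℚ.∣ a ∣ ℚ.≤ B → ℚ.∣ b′ ∣ ℚ.≤ C →
    ℚ.∣ a ℚ.- a′ ∣ ℚ.≤ ζ → ℚ.∣ b ℚ.- b′ ∣ ℚ.≤ ζ →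
    ℚ.∣ a ℚ.* b ℚ.- a′ ℚ.* b′ ∣ ℚ.≤ (B ℚ.+ C) ℚ.* ζ
  *-bound {a} {b} {a′} {b′} {B} {C} {ζ} C>0 ζ>0 a≤B b′≤C da db = begin
    ℚ.∣ a ℚ.* b ℚ.- a′ ℚ.* b′ ∣
      ≡⟨ cong ℚ.∣_∣ (*-split a b a′ b′) ⟩
    ℚ.∣ a ℚ.* (b ℚ.- b′) ℚ.+ (a ℚ.- a′) ℚ.* b′ ∣
      ≤⟨ ℚP.∣p+q∣≤∣p∣+∣q∣ (a ℚ.* (b ℚ.- b′)) ((a ℚ.- a′) ℚ.* b′) ⟩
    ℚ.∣ a ℚ.* (b ℚ.- b′) ∣ ℚ.+ ℚ.∣ (a ℚ.- a′) ℚ.* b′ ∣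
      ≡⟨ cong₂ ℚ._+_ (ℚP.∣p*q∣≡∣p∣*∣q∣ a (b ℚ.- b′)) (ℚP.∣p*q∣≡∣p∣*∣q∣ (a ℚ.- a′) b′) ⟩
    ℚ.∣ a ∣ ℚ.* ℚ.∣ b ℚ.- b′ ∣ ℚ.+ ℚ.∣ a ℚ.- a′ ∣ ℚ.* ℚ.∣ b′ ∣
      ≤⟨ ℚP.+-mono-≤
           (mono-* (ℚP.0≤∣p∣ a) a≤B (ℚP.<⇒≤ ζ>0) db)
           (mono-* (ℚP.0≤∣p∣ (a ℚ.- a′)) da (ℚP.<⇒≤ C>0) b′≤C) ⟩
    B ℚ.* ζ ℚ.+ ζ ℚ.* C
      ≡⟨ factor B ζ C ⟩
    (B ℚ.+ C) ℚ.* ζ ∎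
    where open ℚP.≤-Reasoning

  *-cauchy : ∀ {s t} → IsCauchy s → IsCauchy t → IsCauchy (λ n → s n ℚ.* t n)
  *-cauchy {s} {t} cs ct η η>0 =
    let B , B>0 , M₀ , b = eventually-bounded {s} cs
        C , C>0 , N₀ , c = eventually-bounded {t} ct
        ζ , ζ>0 , Dζ≡η   = divide (B ℚ.+ C) η (ℚP.+-mono-< B>0 C>0) η>0
        M , p = cs ζ ζ>0
        N , q = ct ζ ζ>0
    in (M₀ ℕ.⊔ N₀) ℕ.⊔ (M ℕ.⊔ N) , λ m n m≥ n≥ →
      subst (ℚ.∣ s m ℚ.* t m ℚ.- s n ℚ.* t n ∣ ℚ.≤_) Dζ≡η
        (*-bound C>0 ζ>0
          (b m (≤⊔ˡ {M₀} {N₀} (≤⊔ˡ {M₀ ℕ.⊔ N₀} {M ℕ.⊔ N} m≥)))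
          (c n (≤⊔ʳ {M₀} {N₀} (≤⊔ˡ {M₀ ℕ.⊔ N₀} {M ℕ.⊔ N} n≥)))
          (p m n (≤⊔ˡ {M} {N} (≤⊔ʳ {M₀ ℕ.⊔ N₀} {M ℕ.⊔ N} m≥))
                 (≤⊔ˡ {M} {N} (≤⊔ʳ {M₀ ℕ.⊔ N₀} {M ℕ.⊔ N} n≥)))
          (q m n (≤⊔ʳ {M} {N} (≤⊔ʳ {M₀ ℕ.⊔ N₀} {M ℕ.⊔ N} m≥))
                 (≤⊔ʳ {M} {N} (≤⊔ʳ {M₀ ℕ.⊔ N₀} {M ℕ.⊔ N} n≥))))

open CauchyLemmas

infixl 6 _+_ _-_
infixl 7 _*_
infix  8 -_

fromℚ : ℚ → ℝ
fromℚ q = mkℝ (λ _ → q) (const-cauchy q)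

0ℝ 1ℝ : ℝ
0ℝ = fromℚ 0ℚ
1ℝ = fromℚ 1ℚ

_+_ : ℝ → ℝ → ℝ
x + y = mkℝ (λ n → seq x n ℚ.+ seq y n) (+-cauchy {seq x} {seq y} (cauchy x) (cauchy y))

_*_ : ℝ → ℝ → ℝ
x * y = mkℝ (λ n → seq x n ℚ.* seq y n) (*-cauchy {seq x} {seq y} (cauchy x) (cauchy y))

-_ : ℝ → ℝ
- x = mkℝ (λ n → ℚ.- seq x n) (neg-cauchy {seq x} (cauchy x))

_-_ : ℝ → ℝ → ℝ
x - y = x + (- y)

∣_∣ : ℝ → ℝ
∣ x ∣ = mkℝ (λ n → ℚ.∣ seq x n ∣) (abs-cauchy {seq x} (cauchy x))

+-0-rawMonoid : RawMonoid 0ℓ 0ℓ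
+-0-rawMonoid = record { Carrier = ℝ ; _≈_ = _≈_ ; _∙_ = _+_ ; ε = 0ℝ }

open import Algebra.Definitions.RawMonoid +-0-rawMonoid public using (sum)

-- The largest r ≤ b with r ^ q ≤ m (for q ≠ 0).
iroot≤ : (q m b : ℕ) → ℕ
iroot≤ q m zero = 0
iroot≤ q m (suc b) with suc b ℕ.^ q ℕP.≤? m
... | yes _ = suc b
... | no  _ = iroot≤ q m b

-- ⌊ m ^ (1/q) ⌋
iroot : (q m : ℕ) → ℕ
iroot q m = iroot≤ q m m

-- ⌊ (k+1) m ^ (1/q) ⌋ / (k+1), which is within 1/(k+1) of m ^ (1/q).
rootSeq : (q m : ℕ) → ℕ → ℚ
rootSeq q m k = + iroot q (m ℕ.* suc k ℕ.^ q) ℚ./ suc k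

module RootLemmas where
  iroot≤-lower : ∀ q .{{_ : ℕ.NonZero q}} m b → iroot≤ q m b ℕ.^ q ℕ.≤ m
  iroot≤-lower (suc q) m zero = ℕ.z≤n
  iroot≤-lower (suc q) m (suc b) with suc b ℕ.^ suc q ℕP.≤? m
  ... | yes p = p
  ... | no  _ = iroot≤-lower (suc q) m b

  iroot≤-upper : ∀ q m b → m ℕ.< suc b ℕ.^ q → m ℕ.< suc (iroot≤ q m b) ℕ.^ q
  iroot≤-upper q m zero h = h
  iroot≤-upper q m (suc b) h with suc b ℕ.^ q ℕP.≤? m
  ... | yes _ = h
  ... | no ¬p = iroot≤-upper q m b (ℕP.≰⇒> ¬p)

  iroot-upper : ∀ q .{{_ : ℕ.NonZero q}} m → m ℕ.< suc (iroot q m) ℕ.^ q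
  iroot-upper (suc q) m = iroot≤-upper (suc q) m m
    (ℕP.≤-trans (ℕP.≤-reflexive (sym (ℕP.^-identityʳ (suc m))))
      (ℕP.^-monoʳ-≤ (suc m) {1} {suc q} (ℕ.s≤s ℕ.z≤n)))

  ^-distribʳ-* : ∀ q a b → (a ℕ.* b) ℕ.^ q ≡ a ℕ.^ q ℕ.* b ℕ.^ q
  ^-distribʳ-* zero    a b = refl
  ^-distribʳ-* (suc q) a b = trans (cong (a ℕ.* b ℕ.*_) (^-distribʳ-* q a b))
    (ℕP.[m*n]*[o*p]≡[m*o]*[n*p] a b (a ℕ.^ q) (b ℕ.^ q))

  ^-cancelˡ-< : ∀ q a b → a ℕ.^ q ℕ.< b ℕ.^ q → a ℕ.< b
  ^-cancelˡ-< q a b h with a ℕP.<? b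
  ... | yes p = p
  ... | no ¬p = contradiction (ℕP.<-≤-trans h (ℕP.^-monoˡ-≤ q (ℕP.≮⇒≥ ¬p))) (ℕP.<-irrefl refl)

  root-compare : ∀ q .{{_ : ℕ.NonZero q}} m j k →
    iroot q (m ℕ.* suc j ℕ.^ q) ℕ.* suc k ℕ.≤ suc (iroot q (m ℕ.* suc k ℕ.^ q)) ℕ.* suc j
  root-compare q m j k = ℕP.<⇒≤ (^-cancelˡ-< q (a ℕ.* suc k) (suc b ℕ.* suc j) (begin-strict
    (a ℕ.* suc k) ℕ.^ q
      ≡⟨ ^-distribʳ-* q a (suc k) ⟩
    a ℕ.^ q ℕ.* suc k ℕ.^ q
      ≤⟨ ℕP.*-monoˡ-≤ (suc k ℕ.^ q) (iroot≤-lower q M M) ⟩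
    m ℕ.* suc j ℕ.^ q ℕ.* suc k ℕ.^ q
      ≡⟨ ℕP.*-assoc m _ _ ⟩
    m ℕ.* (suc j ℕ.^ q ℕ.* suc k ℕ.^ q)
      ≡⟨ cong (m ℕ.*_) (ℕP.*-comm (suc j ℕ.^ q) _) ⟩
    m ℕ.* (suc k ℕ.^ q ℕ.* suc j ℕ.^ q)
      ≡⟨ ℕP.*-assoc m _ _ ⟨
    m ℕ.* suc k ℕ.^ q ℕ.* suc j ℕ.^ q
      <⟨ ℕP.*-monoˡ-< (suc j ℕ.^ q) {{ℕP.m^n≢0 (suc j) q}} (iroot-upper q (m ℕ.* suc k ℕ.^ q)) ⟩
    suc b ℕ.^ q ℕ.* suc j ℕ.^ q
      ≡⟨ ^-distribʳ-* q (suc b) (suc j) ⟨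
    (suc b ℕ.* suc j) ℕ.^ q ∎))
    where
    open ℕP.≤-Reasoning
    M a b : ℕ
    M = m ℕ.* suc j ℕ.^ q
    a = iroot q M
    b = iroot q (m ℕ.* suc k ℕ.^ q)

  toℚᵘ-/ : ∀ a j → ℚ.toℚᵘ (+ a ℚ./ suc j) ℚᵘ.≃ ℚᵘ.mkℚᵘ (+ a) j
  toℚᵘ-/ a j = ℚP.toℚᵘ-fromℚᵘ (ℚᵘ.mkℚᵘ (+ a) j)

  frac-≤ : ∀ a j b k → a ℕ.* suc k ℕ.≤ b ℕ.* suc j → + a ℚ./ suc j ℚ.≤ + b ℚ./ suc k
  frac-≤ a j b k h = ℚP.toℚᵘ-cancel-≤
    (ℚᵘP.≤-respˡ-≃ (ℚᵘP.≃-sym (toℚᵘ-/ a j)) (ℚᵘP.≤-respʳ-≃ (ℚᵘP.≃-sym (toℚᵘ-/ b k))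
      (ℚᵘ.*≤* (subst₂ ℤ._≤_ (ℤP.pos-* a (suc k)) (ℤP.pos-* b (suc j)) (ℤ.+≤+ h)))))

  frac-suc : ∀ b k → + suc b ℚ./ suc k ≡ + b ℚ./ suc k ℚ.+ + 1 ℚ./ suc k
  frac-suc b k = ℚP.toℚᵘ-injective (ℚᵘP.≃-trans (toℚᵘ-/ (suc b) k)
    (ℚᵘP.≃-trans (ℚᵘ.*≡* eq)
      (ℚᵘP.≃-trans (ℚᵘP.+-cong (ℚᵘP.≃-sym (toℚᵘ-/ b k)) (ℚᵘP.≃-sym (toℚᵘ-/ 1 k)))
        (ℚᵘP.≃-sym (ℚP.toℚᵘ-homo-+ (+ b ℚ./ suc k) (+ 1 ℚ./ suc k))))))
    where
    nat : ∀ b d → (1 ℕ.+ b) ℕ.* (d ℕ.* d) ≡ (b ℕ.* d ℕ.+ 1 ℕ.* d) ℕ.* d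
    nat = ℕSolver.solve-∀

    eq : + suc b ℤ.* + (suc k ℕ.* suc k) ≡
         (+ b ℤ.* + suc k ℤ.+ + 1 ℤ.* + suc k) ℤ.* + suc k
    eq = trans (sym (ℤP.pos-* (suc b) (suc k ℕ.* suc k)))
      (trans (cong +_ (nat b (suc k)))
        (trans (ℤP.pos-* (b ℕ.* suc k ℕ.+ 1 ℕ.* suc k) (suc k))
          (cong (ℤ._* + suc k) (trans (ℤP.pos-+ (b ℕ.* suc k) (1 ℕ.* suc k))
            (cong₂ ℤ._+_ (ℤP.pos-* b (suc k)) (ℤP.pos-* 1 (suc k)))))))

  archimedean : ∀ η → 0ℚ ℚ.< η → ∃[ N ] (∀ k → N ℕ.≤ k → + 1 ℚ./ suc k ℚ.≤ η)
  archimedean η η>0 = go η {{ℚ.positive η>0}}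
    where
    go : ∀ η .{{_ : ℚ.Positive η}} → ∃[ N ] (∀ k → N ℕ.≤ k → + 1 ℚ./ suc k ℚ.≤ η)
    go η@(mkℚ +[1+ p ] d _) = d , λ k d≤k →
      subst (+ 1 ℚ./ suc k ℚ.≤_) (ℚP.fromℚᵘ-toℚᵘ η)
        (frac-≤ 1 k (suc p) d (ℕP.*-mono-≤ (ℕ.s≤s {0} {p} ℕ.z≤n) (ℕ.s≤s d≤k)))

  rootSeq-≤ : ∀ q .{{_ : ℕ.NonZero q}} m j k →
    rootSeq q m j ℚ.- rootSeq q m k ℚ.≤ + 1 ℚ./ suc k
  rootSeq-≤ q m j k = a≤b+c⇒a-b≤c {rootSeq q m j} {rootSeq q m k} {+ 1 ℚ./ suc k}
    (subst (rootSeq q m j ℚ.≤_) (frac-suc b k)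
      (frac-≤ (iroot q (m ℕ.* suc j ℕ.^ q)) j (suc b) k (root-compare q m j k)))
    where
    b : ℕ
    b = iroot q (m ℕ.* suc k ℕ.^ q)

  root-cauchy : ∀ q .{{_ : ℕ.NonZero q}} m → IsCauchy (rootSeq q m)
  root-cauchy q m η η>0 with archimedean η η>0
  ... | N , h = N , λ j k N≤j N≤k → ∣-∣-bound {rootSeq q m j} {rootSeq q m k} {η}
    (ℚP.≤-trans (rootSeq-≤ q m j k) (h k N≤k))
    (ℚP.≤-trans (rootSeq-≤ q m k j) (h j N≤j))

open RootLemmas using (root-cauchy)

root : (q : ℕ) .{{_ : ℕ.NonZero q}} → ℕ → ℝ
root q m = mkℝ (rootSeq q m) (root-cauchy q m)

infixr 8 _^_

-- n ^ (a/b) = (n ^ a) ^ (1/b). Meaningful for δ ≥ 0 only: the sign of δ is ignored.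
_^_ : ℕ → ℚ → ℝ
n ^ δ = root (ℚ.↧ₙ δ) (n ℕ.^ ℤ.∣ ℚ.↥ δ ∣)

-- (x , true) is the literal x, and (x , false) is its negation.
Literal : ℕ → Set
Literal n = Fin n × Bool

-- Literals may repeat, so clauses with fewer than three literals are covered.
Clause : ℕ → Set
Clause n = Vec (Literal n) 3

Formula : ℕ → Set
Formula n = List (Clause n)

-- `Subset n` is `Vec Bool n`, so an assignment σ and the set σ⁻¹(1) are the
-- same object.
Satisfies : ∀ {n} → Subset n → Formula n → Set
Satisfies σ = All (Any (λ (x , b) → lookup σ x ≡ b))

Satisfiable : ∀ {n} → Formula n → Set
Satisfiable Φ = ∃[ σ ] Satisfies σ Φ

record Weights (n : ℕ) : Set where
  field
    weight : Fin n → ℝ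
    nonNeg : ∀ x → 0ℝ ≤ weight x

open Weights public

infix 4 _≈ᵂ_

_≈ᵂ_ : ∀ {n} → Weights n → Weights n → Set
w ≈ᵂ w′ = ∀ x → weight w x ≈ weight w′ x

‖_-_‖₁ : ∀ {n} → Weights n → Weights n → ℝ
‖ w - w′ ‖₁ = sum λ x → ∣ weight w x - weight w′ x ∣

∑∈ : ∀ {n} → Subset n → (Fin n → ℝ) → ℝ
∑∈ A f = sum λ x → if lookup A x then f x else 0ℝ

totalWeight : ∀ {n} → Weights n → Subset n → ℝ
totalWeight w A = ∑∈ A (weight w)

IsOptimum : ∀ {n} → Formula n → Weights n → ℝ → Set
IsOptimum Φ w opt =
  (∃[ σ ] (Satisfies σ Φ × totalWeight w σ ≈ opt)) ×
  (∀ σ → Satisfies σ Φ → totalWeight w σ ≤ opt)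

∑⊆ : ∀ {n} → (Subset n → ℝ) → ℝ
∑⊆ {zero}  f = f []
∑⊆ {suc n} f = ∑⊆ (λ A → f (outside ∷ A)) + ∑⊆ (λ A → f (inside ∷ A))

record Distribution (n : ℕ) : Set where
  field
    prob      : Subset n → ℝ
    prob≥0    : ∀ A → 0ℝ ≤ prob A
    prob-sum  : ∑⊆ prob ≈ 1ℝ

open Distribution public

expectation : ∀ {n} → Distribution n → (Subset n → ℝ) → ℝ
expectation P f = ∑⊆ λ A → prob P A * f A

-- An algorithm is given by its output distribution on every instance.
-- `run-cong`: the output depends on the real weights, not on the Cauchy
-- sequences representing them.
record Algorithm : Set where
  field
    run      : ∀ {n} → Formula n → Weights n → Distribution n
    run-cong : ∀ {n} (Φ : Formula n) {w w′ : Weights n} → w ≈ᵂ w′ →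
               ∀ A → prob (run Φ w) A ≈ prob (run Φ w′) A

open Algorithm public

-- Unsatisfiable formulas have no solutions, so nothing is required on them.
IsApproximation : ℝ → Algorithm → Set
IsApproximation α 𝒜 = ∀ {n} (Φ : Formula n) → Satisfiable Φ → ∀ w →
  (∀ A → ¬ Satisfies A Φ → prob (run 𝒜 Φ w) A ≈ 0ℝ) ×
  (∀ opt → IsOptimum Φ w opt → α * opt ≤ expectation (run 𝒜 Φ w) (totalWeight w))

d-w : ∀ {n} → Subset n → Weights n → Subset n → Weights n → ℝ
d-w A w A′ w′ =
  ∑∈ (A ∩ A′) (λ x → ∣ weight w x - weight w′ x ∣)
  + ∑∈ (A ─ A′) (weight w)
  + ∑∈ (A′ ─ A) (weight w′)

record Coupling {n : ℕ} (P Q : Distribution n) : Set where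
  field
    joint     : Subset n → Subset n → ℝ
    joint≥0   : ∀ A A′ → 0ℝ ≤ joint A A′
    marginalˡ : ∀ A → ∑⊆ (λ A′ → joint A A′) ≈ prob P A
    marginalʳ : ∀ A′ → ∑⊆ (λ A → joint A A′) ≈ prob Q A′

open Coupling public

expectedDistance : ∀ {n} {P Q : Distribution n} → Coupling P Q →
  Weights n → Weights n → ℝ
expectedDistance π w w′ = ∑⊆ λ A → ∑⊆ λ A′ → joint π A A′ * d-w A w A′ w′

-- inf f ≤ v: no lower bound of f exceeds v. Stated without assuming that the
-- infimum is given as an element of ℝ.
Inf≤ : {I : Set} → (I → ℝ) → ℝ → Set
Inf≤ f v = ∀ l → (∀ i → l ≤ f i) → l ≤ v

-- EM((P , w) , (Q , w′)) ≤ v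
EM≤ : ∀ {n} → Distribution n → Weights n → Distribution n → Weights n → ℝ → Set
EM≤ P w Q w′ = Inf≤ λ (π : Coupling P Q) → expectedDistance π w w′

-- K bounds every ratio EM / ‖w - w′‖₁ with w ≠ w′ (denominator cleared).
IsLipschitzBound : ∀ {n} → Algorithm → Formula n → ℝ → Set
IsLipschitzBound 𝒜 Φ K = ∀ w w′ → ¬ (w ≈ᵂ w′) →
  EM≤ (run 𝒜 Φ w) w (run 𝒜 Φ w′) w′ (K * ‖ w - w′ ‖₁)

-- The Lipschitz constant, a supremum that may be +∞, is at least L:
-- every upper bound of the ratios is at least L.
LipschitzConstant≥ : ∀ {n} → Algorithm → Formula n → ℝ → Set
LipschitzConstant≥ 𝒜 Φ L = ∀ K → IsLipschitzBound 𝒜 Φ K → L ≤ K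

{-# OPTIONS --safe #-}
module Submission where

-- Take the t-th tensor power of the parity code of length 3: its words have length 3ᵗ,
-- carry k = 2ᵗ information bits, differ pairwise in at least 2ᵗ places, and are cut out
-- by constraints on three bits each. Adding the complement of every bit and copies y, ȳ
-- of the information bits gives a formula all of whose solutions have the same weight on
-- the code variables, if these are all weighted 2ᵗ. For x ∈ {0,1}ᵏ, a bonus 3ᵗ on each
-- literal y_j = x_j makes the encoding of x optimal, and a 7/8-approximation must agree with
-- x in 3/4 of the information bits on average. Flipping x_j changes the weights by 2·3ᵗ in
-- ℓ₁. If both outputs are the same codeword, only one of them agrees with its target at j,
-- and otherwise their distance is at least 2·4ᵗ. Averaging over all x and j, a quarter of
-- 2·4ᵗ is at most the Lipschitz constant times 3ᵗ, so the constant is at least (4/3)ᵗ/2,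
-- while n is of order 3ᵗ and (4/3)⁴ > 3.

import Algebra.Properties.CommutativeMonoid.Sum
import Algebra.Properties.CommutativeSemigroup
import Data.Integer.Properties as ℤP
import Data.Nat.Properties as ℕP
import Data.Nat.Tactic.RingSolver as ℕSolver
import Data.Rational.Properties as ℚP
import Data.Rational.Unnormalised.Base as ℚᵘ
import Data.Rational.Unnormalised.Properties as ℚᵘP
open import Algebra.Bundles using (CommutativeSemiring)
open import Algebra.Bundles.Raw using (RawRing)
open import Algebra.Solver.Ring.AlmostCommutativeRing using (_-Raw-AlmostCommutative⟶_; fromCommutativeSemiring)
open import Algebra.Structures using (IsCommutativeSemiring)
open import Data.Bool.Base using (Bool; true; false; not; _∧_; _xor_; if_then_else_)
open import Data.Bool.Properties using (not-injective; not-involutive; not-¬; ¬-not; ∧-zeroʳ; ∧-identityʳ; xor-same; xor-comm) renaming (_≟_ to _≟ᵇ_)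
open import Data.Fin.Base using (Fin; zero; suc; _↑ˡ_; _↑ʳ_; combine; remQuot; inject₁)
open import Data.Fin.Patterns using (0F; 1F; 2F)
open import Data.Fin.Properties using (remQuot-combine; combine-remQuot; suc-injective)
open import Data.Fin.Subset using (Subset; inside; outside; _∩_; _─_)
open import Data.Integer.Base as ℤ using (+_)
open import Data.List.Base using ([]; _∷_; _++_; concat; tabulate)
open import Data.List.Relation.Unary.All using ([]; _∷_; all?)
open import Data.List.Relation.Unary.All.Properties using (++⁺; ++⁻ˡ; ++⁻ʳ; concat⁺; concat⁻; tabulate⁺; tabulate⁻)
open import Data.Maybe.Base as Maybe using ()
open import Data.Nat.Base as ℕ using (ℕ; zero; suc)
open import Data.Product.Base using (_×_; _,_; ∃-syntax; proj₁; proj₂)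
open import Data.Rational.Base as ℚ using (ℚ; 0ℚ; 1ℚ)
open import Data.Rational.Solver using (module +-*-Solver)
open import Data.Sum.Base using (_⊎_; inj₁; inj₂)
open import Data.Unit.Base using (⊤; tt)
open import Data.Vec.Base as Vec using ([]; _∷_; lookup; _[_]%=_)
open import Data.Vec.Functional as Vector using ()
open import Data.Vec.Functional.Properties using () renaming (lookup-++ˡ to ++-↑ˡ; lookup-++ʳ to ++-↑ʳ)
open import Data.Vec.Properties using (lookup∘tabulate; lookup∘updateAt; lookup∘updateAt′)
open import Data.Vec.Relation.Unary.Any using (Any; here; there; any?)
open import Function.Base using (_∘_)
open import Level using (0ℓ)
open import Relation.Binary.Bundles using (Poset)
open import Relation.Binary.PropositionalEquality as ≡ using (_≡_; _≗_; cong; cong₂; subst; subst₂)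
open import Relation.Binary.Structures using (IsEquivalence; IsPartialOrder)
open import Relation.Nullary using (¬_; yes; no; Dec; contradiction)
open import Relation.Nullary.Decidable using (dec⇒maybe)
open Algebra.Properties.CommutativeMonoid.Sum ℕP.+-0-commutativeMonoid
  using () renaming (sum to sumℕ; sum-cong-≗ to sumℕ-cong; ∑-distrib-+ to sumℕ-distrib-+)

-- What the code must provide is a dimension k and a distance d with k * d above the length N by a
-- power of N. Give each code variable and its complement weight k: the base weight is then k * N,
-- equal to the total bonus of k bits worth N each; distinct codewords are 2 * k * d apart, while
-- flipping one target bit moves the weights by only 2 * N. The parity code has 2 * 2 > 3, and all
-- three parameters multiply under tensor powers, whence the gain (4/3)^t.
--
-- Since base and bonus balance, losing a fraction ε of the optimum costs a fraction 2ε of the bits.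
-- Two targets that are opposite at bit j are then met with frequencies adding up, on average, to
-- 2(1 - 2ε), which exceeds 1 when ε < 1/4; a single codeword can meet only one of them, so the
-- outputs must differ with constant probability.
--
-- The algorithm may choose for each target which bits to miss, so no pair (x, j) can be fixed in
-- advance. Flipping bit j permutes the targets, and hence the average over all pairs counts every
-- success probability exactly twice.

record IsOrderedSemiring {C : Set} (_≃_ _≼_ : C → C → Set) (_⊕_ _⊗_ _⊖_ : C → C → C)
  (0ᶜ 1ᶜ : C) (ι : ℕ → C) (sum : ∀ {n} → (Fin n → C) → C) (∑⊆ : ∀ {n} → (Subset n → C) → C) : Set where
  field
    isCommutativeSemiring : IsCommutativeSemiring _≃_ _⊕_ _⊗_ 0ᶜ 1ᶜ
    ≼-isPartialOrder : IsPartialOrder _≃_ _≼_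
    +-mono-≼ : ∀ {x y z w} → x ≼ y → z ≼ w → (x ⊕ z) ≼ (y ⊕ w)
    +-cancelˡ-≼ : ∀ z {x y} → (z ⊕ x) ≼ (z ⊕ y) → x ≼ y
    x-y+y≈x : ∀ x y → ((x ⊖ y) ⊕ y) ≃ x
    ι-zero : ι 0 ≃ 0ᶜ
    ι-suc : ∀ m → ι (suc m) ≃ (1ᶜ ⊕ ι m)
    sum-zero : (f : Fin 0 → C) → sum f ≃ 0ᶜ
    sum-suc : ∀ {n} (f : Fin (suc n) → C) → sum f ≃ (f zero ⊕ sum (λ i → f (suc i)))
    -- The only form of division in the argument. Products are compared only through natural
    -- multiples, so monotonicity of multiplication is not among the laws.
    sum-const-cancel : ∀ m {x y} → sum {suc m} (λ _ → x) ≼ sum {suc m} (λ _ → y) → x ≼ y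
    ∑⊆-[] : (f : Subset 0 → C) → ∑⊆ f ≃ f []
    ∑⊆-∷ : ∀ {n} (f : Subset (suc n) → C) →
      ∑⊆ f ≃ (∑⊆ (λ A → f (outside ∷ A)) ⊕ ∑⊆ (λ A → f (inside ∷ A)))

-- Unifying terms built with the multiplication of Cauchy sequences unfolds their
-- moduli of convergence, so arguments that only use the laws of an ordered
-- semiring are given over an abstract one. It is unbundled, so that instantiating
-- `lipschitz-bound` yields the operations of Defs themselves.
module SubsetSums {C : Set} (_≃_ _≼_ : C → C → Set) (_⊕_ _⊗_ _⊖_ : C → C → C)
  (0ᶜ 1ᶜ : C) (ι : ℕ → C) (sum : ∀ {n} → (Fin n → C) → C) (∑⊆ : ∀ {n} → (Subset n → C) → C)
  (laws : IsOrderedSemiring _≃_ _≼_ _⊕_ _⊗_ _⊖_ 0ᶜ 1ᶜ ι sum ∑⊆) where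

  open IsOrderedSemiring laws hiding (isCommutativeSemiring)

  R : CommutativeSemiring 0ℓ 0ℓ
  R = record { isCommutativeSemiring = IsOrderedSemiring.isCommutativeSemiring laws }

  open CommutativeSemiring R hiding (zero)

  infix 4 _⊑_
  _⊑_ : Carrier → Carrier → Set
  _⊑_ = _≼_

  infixl 6 _-_
  _-_ : Carrier → Carrier → Carrier
  _-_ = _⊖_

  ≼-poset : Poset 0ℓ 0ℓ 0ℓ
  ≼-poset = record { isPartialOrder = ≼-isPartialOrder }

  open IsPartialOrder ≼-isPartialOrder using ()
    renaming (refl to ≼-refl; reflexive to ≼-reflexive; trans to ≼-trans)
  open import Relation.Binary.Reasoning.PartialOrder ≼-poset
  open import Algebra.Properties.CommutativeSemigroup +-commutativeSemigroup using (interchange)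
  open import Algebra.Properties.CommutativeSemigroup *-commutativeSemigroup using (x∙yz≈y∙xz)

  -- Natural multiples in an ordered semiring

  ι-suc-* : ∀ m x → ι (suc m) * x ≈ x + ι m * x
  ι-suc-* m x = trans (*-congʳ (ι-suc m)) (trans (distribʳ x 1# (ι m)) (+-congʳ (*-identityˡ x)))

  ι-1 : ι 1 ≈ 1#
  ι-1 = trans (ι-suc 0) (trans (+-congˡ ι-zero) (+-identityʳ 1#))

  ι-+ : ∀ a b → ι (a ℕ.+ b) ≈ ι a + ι b
  ι-+ zero    b = sym (trans (+-congʳ ι-zero) (+-identityˡ (ι b)))
  ι-+ (suc a) b = begin-equality
    ι (suc (a ℕ.+ b))   ≈⟨ ι-suc (a ℕ.+ b) ⟩
    1# + ι (a ℕ.+ b)    ≈⟨ +-congˡ (ι-+ a b) ⟩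
    1# + (ι a + ι b)    ≈⟨ +-assoc 1# (ι a) (ι b) ⟨
    1# + ι a + ι b      ≈⟨ +-congʳ (ι-suc a) ⟨
    ι (suc a) + ι b     ∎

  ι-* : ∀ a b → ι (a ℕ.* b) ≈ ι a * ι b
  ι-* zero    b = trans ι-zero (sym (trans (*-congʳ ι-zero) (zeroˡ (ι b))))
  ι-* (suc a) b = trans (ι-+ b (a ℕ.* b)) (trans (+-congˡ (ι-* a b)) (sym (ι-suc-* a (ι b))))

  ι0* : ∀ x → ι 0 * x ≈ 0#
  ι0* x = trans (*-congʳ ι-zero) (zeroˡ x)

  *ι-nonNeg : ∀ {x} m → 0# ⊑ x → 0# ⊑ x * ι m
  *ι-nonNeg {x} zero 0≼x = ≼-reflexive (sym (trans (*-congˡ ι-zero) (zeroʳ x)))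
  *ι-nonNeg {x} (suc m) 0≼x = begin
    0#              ≈⟨ +-identityˡ 0# ⟨
    0# + 0#         ≤⟨ +-mono-≼ 0≼x (*ι-nonNeg m 0≼x) ⟩
    x + x * ι m     ≈⟨ +-congˡ (*-comm x (ι m)) ⟩
    x + ι m * x     ≈⟨ ι-suc-* m x ⟨
    ι (suc m) * x   ≈⟨ *-comm _ x ⟩
    x * ι (suc m)   ∎

  -- With b = a + o, the right side exceeds the left by the nonnegative term `x * ι o`.
  *ι-monoʳ : ∀ {x a b} → 0# ⊑ x → a ℕ.≤ b → x * ι a ⊑ x * ι b
  *ι-monoʳ {x} {a} 0≼x a≤b with ℕP.m≤n⇒∃[o]m+o≡n a≤b
  ... | o , ≡.refl = begin
    x * ι a            ≈⟨ +-identityʳ _ ⟨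
    x * ι a + 0#       ≤⟨ +-mono-≼ ≼-refl (*ι-nonNeg o 0≼x) ⟩
    x * ι a + x * ι o  ≈⟨ distribˡ x (ι a) (ι o) ⟨
    x * (ι a + ι o)    ≈⟨ *-congˡ (ι-+ a o) ⟨
    x * ι (a ℕ.+ o)    ∎

  ι*-mono : ∀ {x y} m → x ⊑ y → ι m * x ⊑ ι m * y
  ι*-mono {x} {y} zero    p = ≼-reflexive (trans (ι0* x) (sym (ι0* y)))
  ι*-mono {x} {y} (suc m) p = begin
    ι (suc m) * x  ≈⟨ ι-suc-* m x ⟩
    x + ι m * x    ≤⟨ +-mono-≼ p (ι*-mono m p) ⟩
    y + ι m * y    ≈⟨ ι-suc-* m y ⟨
    ι (suc m) * y  ∎

  -- Finite sums over indices and over subsets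

  sum-cong : ∀ {n} {f g : Fin n → Carrier} → (∀ i → f i ≈ g i) → sum f ≈ sum g
  sum-cong {zero}  {f} {g} p = trans (sum-zero f) (sym (sum-zero g))
  sum-cong {suc n} {f} {g} p = trans (sum-suc f)
    (trans (+-cong (p zero) (sum-cong (λ i → p (suc i)))) (sym (sum-suc g)))

  sum-mono : ∀ {n} {f g : Fin n → Carrier} → (∀ i → f i ⊑ g i) → sum f ⊑ sum g
  sum-mono {zero}  {f} {g} p = ≼-reflexive (trans (sum-zero f) (sym (sum-zero g)))
  sum-mono {suc n} {f} {g} p = begin
    sum f                             ≈⟨ sum-suc f ⟩
    f zero + sum (λ i → f (suc i))    ≤⟨ +-mono-≼ (p zero) (sum-mono (λ i → p (suc i))) ⟩
    g zero + sum (λ i → g (suc i))    ≈⟨ sum-suc g ⟨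
    sum g                             ∎

  ∑-distrib-+ : ∀ {n} (f g : Fin n → Carrier) → sum (λ i → f i + g i) ≈ sum f + sum g
  ∑-distrib-+ {zero}  f g = trans (sum-zero _)
    (trans (sym (+-identityˡ 0#)) (sym (+-cong (sum-zero f) (sum-zero g))))
  ∑-distrib-+ {suc n} f g = begin-equality
    sum (λ i → f i + g i)
      ≈⟨ sum-suc _ ⟩
    f zero + g zero + sum (λ i → f (suc i) + g (suc i))
      ≈⟨ +-congˡ (∑-distrib-+ (λ i → f (suc i)) (λ i → g (suc i))) ⟩
    f zero + g zero + (sum (λ i → f (suc i)) + sum (λ i → g (suc i)))
      ≈⟨ interchange _ _ _ _ ⟩
    f zero + sum (λ i → f (suc i)) + (g zero + sum (λ i → g (suc i)))
      ≈⟨ +-cong (sum-suc f) (sum-suc g) ⟨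
    sum f + sum g ∎

  sum-const : ∀ k x → sum {k} (λ _ → x) ≈ ι k * x
  sum-const zero    x = trans (sum-zero _) (sym (ι0* x))
  sum-const (suc k) x = trans (sum-suc _) (trans (+-congˡ (sum-const k x)) (sym (ι-suc-* k x)))

  ι*-cancel : ∀ m .{{_ : ℕ.NonZero m}} {x y} → ι m * x ⊑ ι m * y → x ⊑ y
  ι*-cancel (suc m) {x} {y} p = sum-const-cancel m (begin
    sum {suc m} (λ _ → x)  ≈⟨ sum-const (suc m) x ⟩
    ι (suc m) * x          ≤⟨ p ⟩
    ι (suc m) * y          ≈⟨ sum-const (suc m) y ⟨
    sum {suc m} (λ _ → y)  ∎)

  *-distribˡ-sum : ∀ {n} x (f : Fin n → Carrier) → x * sum f ≈ sum (λ i → x * f i)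
  *-distribˡ-sum {zero}  x f = trans (*-congˡ (sum-zero f)) (trans (zeroʳ x) (sym (sum-zero _)))
  *-distribˡ-sum {suc n} x f = trans (*-congˡ (sum-suc f)) (trans (distribˡ x _ _)
    (trans (+-congˡ (*-distribˡ-sum x (λ i → f (suc i)))) (sym (sum-suc _))))

  ∑⊆-cong : ∀ {n} {f g : Subset n → Carrier} → (∀ A → f A ≈ g A) → ∑⊆ f ≈ ∑⊆ g
  ∑⊆-cong {zero}  {f} {g} p = trans (∑⊆-[] f) (trans (p []) (sym (∑⊆-[] g)))
  ∑⊆-cong {suc n} {f} {g} p = trans (∑⊆-∷ f) (trans
    (+-cong (∑⊆-cong (λ A → p (outside ∷ A))) (∑⊆-cong (λ A → p (inside ∷ A))))
    (sym (∑⊆-∷ g)))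

  ∑⊆-mono : ∀ {n} {f g : Subset n → Carrier} → (∀ A → f A ⊑ g A) → ∑⊆ f ⊑ ∑⊆ g
  ∑⊆-mono {zero} {f} {g} p = begin
    ∑⊆ f  ≈⟨ ∑⊆-[] f ⟩
    f []  ≤⟨ p [] ⟩
    g []  ≈⟨ ∑⊆-[] g ⟨
    ∑⊆ g  ∎
  ∑⊆-mono {suc n} {f} {g} p = begin
    ∑⊆ f ≈⟨ ∑⊆-∷ f ⟩
    ∑⊆ (λ A → f (outside ∷ A)) + ∑⊆ (λ A → f (inside ∷ A))
      ≤⟨ +-mono-≼ (∑⊆-mono (λ A → p (outside ∷ A))) (∑⊆-mono (λ A → p (inside ∷ A))) ⟩
    ∑⊆ (λ A → g (outside ∷ A)) + ∑⊆ (λ A → g (inside ∷ A)) ≈⟨ ∑⊆-∷ g ⟨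
    ∑⊆ g ∎

  ∑⊆-distrib-+ : ∀ {n} (f g : Subset n → Carrier) → ∑⊆ (λ A → f A + g A) ≈ ∑⊆ f + ∑⊆ g
  ∑⊆-distrib-+ {zero}  f g = trans (∑⊆-[] _) (sym (+-cong (∑⊆-[] f) (∑⊆-[] g)))
  ∑⊆-distrib-+ {suc n} f g = begin-equality
    ∑⊆ (λ A → f A + g A) ≈⟨ ∑⊆-∷ _ ⟩
    ∑⊆ (λ A → f (outside ∷ A) + g (outside ∷ A)) + ∑⊆ (λ A → f (inside ∷ A) + g (inside ∷ A))
      ≈⟨ +-cong (∑⊆-distrib-+ _ _) (∑⊆-distrib-+ _ _) ⟩
    ∑⊆ (λ A → f (outside ∷ A)) + ∑⊆ (λ A → g (outside ∷ A)) +
      (∑⊆ (λ A → f (inside ∷ A)) + ∑⊆ (λ A → g (inside ∷ A)))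
      ≈⟨ interchange _ _ _ _ ⟩
    ∑⊆ (λ A → f (outside ∷ A)) + ∑⊆ (λ A → f (inside ∷ A)) +
      (∑⊆ (λ A → g (outside ∷ A)) + ∑⊆ (λ A → g (inside ∷ A)))
      ≈⟨ +-cong (∑⊆-∷ f) (∑⊆-∷ g) ⟨
    ∑⊆ f + ∑⊆ g ∎

  *-distribˡ-∑⊆ : ∀ {n} x (f : Subset n → Carrier) → x * ∑⊆ f ≈ ∑⊆ (λ A → x * f A)
  *-distribˡ-∑⊆ {zero}  x f = trans (*-congˡ (∑⊆-[] f)) (sym (∑⊆-[] _))
  *-distribˡ-∑⊆ {suc n} x f = begin-equality
    x * ∑⊆ f ≈⟨ *-congˡ (∑⊆-∷ f) ⟩
    x * (∑⊆ (λ A → f (outside ∷ A)) + ∑⊆ (λ A → f (inside ∷ A))) ≈⟨ distribˡ x _ _ ⟩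
    x * ∑⊆ (λ A → f (outside ∷ A)) + x * ∑⊆ (λ A → f (inside ∷ A))
      ≈⟨ +-cong (*-distribˡ-∑⊆ x _) (*-distribˡ-∑⊆ x _) ⟩
    ∑⊆ (λ A → x * f (outside ∷ A)) + ∑⊆ (λ A → x * f (inside ∷ A)) ≈⟨ ∑⊆-∷ _ ⟨
    ∑⊆ (λ A → x * f A) ∎

  *-distribʳ-∑⊆ : ∀ {n} x (f : Subset n → Carrier) → ∑⊆ f * x ≈ ∑⊆ (λ A → f A * x)
  *-distribʳ-∑⊆ x f = trans (*-comm _ x)
    (trans (*-distribˡ-∑⊆ x f) (∑⊆-cong (λ A → *-comm x (f A))))

  ∑⊆-0 : ∀ n → ∑⊆ {n} (λ _ → 0#) ≈ 0#
  ∑⊆-0 n = trans (∑⊆-cong (λ _ → sym (zeroˡ 0#)))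
    (trans (sym (*-distribˡ-∑⊆ {n} 0# (λ _ → 0#))) (zeroˡ _))

  ∑⊆-comm : ∀ {m n} (f : Subset m → Subset n → Carrier) →
    ∑⊆ (λ A → ∑⊆ (λ B → f A B)) ≈ ∑⊆ (λ B → ∑⊆ (λ A → f A B))
  ∑⊆-comm {zero}  f = trans (∑⊆-[] _) (∑⊆-cong (λ B → sym (∑⊆-[] (λ A → f A B))))
  ∑⊆-comm {suc m} f = begin-equality
    ∑⊆ (λ A → ∑⊆ (λ B → f A B)) ≈⟨ ∑⊆-∷ _ ⟩
    ∑⊆ (λ A → ∑⊆ (λ B → f (outside ∷ A) B)) + ∑⊆ (λ A → ∑⊆ (λ B → f (inside ∷ A) B))
      ≈⟨ +-cong (∑⊆-comm _) (∑⊆-comm _) ⟩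
    ∑⊆ (λ B → ∑⊆ (λ A → f (outside ∷ A) B)) + ∑⊆ (λ B → ∑⊆ (λ A → f (inside ∷ A) B))
      ≈⟨ ∑⊆-distrib-+ _ _ ⟨
    ∑⊆ (λ B → ∑⊆ (λ A → f (outside ∷ A) B) + ∑⊆ (λ A → f (inside ∷ A) B))
      ≈⟨ ∑⊆-cong (λ B → ∑⊆-∷ (λ A → f A B)) ⟨
    ∑⊆ (λ B → ∑⊆ (λ A → f A B)) ∎

  ∑⊆-sum-comm : ∀ {m n} (f : Subset m → Fin n → Carrier) →
    ∑⊆ (λ A → sum (f A)) ≈ sum (λ j → ∑⊆ (λ A → f A j))
  ∑⊆-sum-comm {m} {zero}  f = trans (∑⊆-cong (λ A → sum-zero (f A)))
    (trans (∑⊆-0 m) (sym (sum-zero _)))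
  ∑⊆-sum-comm {m} {suc n} f = trans (∑⊆-cong (λ A → sum-suc (f A))) (trans (∑⊆-distrib-+ _ _)
    (trans (+-congˡ (∑⊆-sum-comm {m} {n} (λ A j → f A (suc j)))) (sym (sum-suc _))))

  ∑⊆-const : ∀ n x → ∑⊆ {n} (λ _ → x) ≈ ι (2 ℕ.^ n) * x
  ∑⊆-const zero    x = trans (∑⊆-[] _) (sym (trans (*-congʳ ι-1) (*-identityˡ x)))
  ∑⊆-const (suc n) x = begin-equality
    ∑⊆ {suc n} (λ _ → x)                       ≈⟨ ∑⊆-∷ _ ⟩
    ∑⊆ {n} (λ _ → x) + ∑⊆ {n} (λ _ → x)        ≈⟨ +-cong (∑⊆-const n x) (∑⊆-const n x) ⟩
    ι (2 ℕ.^ n) * x + ι (2 ℕ.^ n) * x          ≈⟨ distribʳ x _ _ ⟨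
    (ι (2 ℕ.^ n) + ι (2 ℕ.^ n)) * x            ≈⟨ *-congʳ (ι-+ (2 ℕ.^ n) (2 ℕ.^ n)) ⟨
    ι (2 ℕ.^ n ℕ.+ 2 ℕ.^ n) * x                ≡⟨ cong (λ m → ι (2 ℕ.^ n ℕ.+ m) * x) (ℕP.+-identityʳ (2 ℕ.^ n)) ⟨
    ι (2 ℕ.^ suc n) * x                        ∎

  -- Negating bit j is an involution on subsets; at the head it merely swaps the two halves of
  -- `∑⊆-∷`. This is why flipped targets have the same average as the targets.
  ∑⊆-flip : ∀ {n} (j : Fin n) (f : Subset n → Carrier) → ∑⊆ (λ A → f (A [ j ]%= not)) ≈ ∑⊆ f
  ∑⊆-flip zero    f = trans (∑⊆-∷ _) (trans (+-comm _ _) (sym (∑⊆-∷ f)))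
  ∑⊆-flip (suc j) f = trans (∑⊆-∷ _) (trans (+-cong (∑⊆-flip j _) (∑⊆-flip j _)) (sym (∑⊆-∷ f)))

  -- Expectations of natural-valued functions

  𝔼 : ∀ {n} → (Subset n → Carrier) → (Subset n → ℕ) → Carrier
  𝔼 p f = ∑⊆ (λ A → p A * ι (f A))

  -- The alternative `p A ≈ 0#` restricts the comparison to the support: nothing is known about the
  -- weight of infeasible outcomes, but they have probability zero.
  𝔼-mono : ∀ {n} {p : Subset n → Carrier} {f g : Subset n → ℕ} → (∀ A → 0# ⊑ p A) →
    (∀ A → p A ≈ 0# ⊎ f A ℕ.≤ g A) → 𝔼 p f ⊑ 𝔼 p g
  𝔼-mono {p = p} {f} {g} p≥0 h = ∑⊆-mono pointwise
    where
    pointwise : ∀ A → p A * ι (f A) ⊑ p A * ι (g A)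
    pointwise A with h A
    ... | inj₁ e = ≼-reflexive (trans (trans (*-congʳ e) (zeroˡ _))
                                      (sym (trans (*-congʳ e) (zeroˡ _))))
    ... | inj₂ q = *ι-monoʳ (p≥0 A) q

  𝔼-+ : ∀ {n} (p : Subset n → Carrier) (f g : Subset n → ℕ) →
    𝔼 p (λ A → f A ℕ.+ g A) ≈ 𝔼 p f + 𝔼 p g
  𝔼-+ p f g = trans (∑⊆-cong (λ A → trans (*-congˡ (ι-+ (f A) (g A))) (distribˡ _ _ _)))
    (∑⊆-distrib-+ _ _)

  𝔼-const : ∀ {n} (p : Subset n → Carrier) → ∑⊆ p ≈ 1# → ∀ c → 𝔼 p (λ _ → c) ≈ ι c
  𝔼-const p e c = trans (sym (*-distribʳ-∑⊆ (ι c) p)) (trans (*-congʳ e) (*-identityˡ _))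

  𝔼-scale : ∀ {n} (p : Subset n → Carrier) c (f : Subset n → ℕ) →
    𝔼 p (λ A → c ℕ.* f A) ≈ ι c * 𝔼 p f
  𝔼-scale p c f = trans
    (∑⊆-cong (λ A → trans (*-congˡ (ι-* c (f A))) (x∙yz≈y∙xz (p A) (ι c) (ι (f A)))))
    (sym (*-distribˡ-∑⊆ (ι c) _))

  ι-sum : ∀ {n} (f : Fin n → ℕ) → ι (sumℕ f) ≈ sum (λ i → ι (f i))
  ι-sum {zero}  f = trans ι-zero (sym (sum-zero _))
  ι-sum {suc n} f = trans (ι-+ (f zero) _)
    (trans (+-congˡ (ι-sum (λ i → f (suc i)))) (sym (sum-suc _)))

  𝔼-sum : ∀ {n k} (p : Subset n → Carrier) (f : Fin k → Subset n → ℕ) →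
    𝔼 p (λ A → sumℕ (λ j → f j A)) ≈ sum (λ j → 𝔼 p (f j))
  𝔼-sum p f = trans
    (∑⊆-cong (λ A → trans (*-congˡ (ι-sum (λ j → f j A))) (*-distribˡ-sum (p A) (λ j → ι (f j A)))))
    (∑⊆-sum-comm (λ A j → p A * ι (f j A)))

  -- Both expectations are rewritten as integrals against the joint distribution π, where the
  -- pointwise hypothesis applies; the constant D integrates to itself because π has total mass 1.
  coupling-bound : ∀ {n} {p q : Subset n → Carrier} {π : Subset n → Subset n → Carrier}
    {a b : Subset n → ℕ} {dist : Subset n → Subset n → ℕ} {D : ℕ} →
    ∑⊆ p ≈ 1# → (∀ A B → 0# ⊑ π A B) →
    (∀ A → ∑⊆ (λ B → π A B) ≈ p A) → (∀ B → ∑⊆ (λ A → π A B) ≈ q B) →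
    (∀ A B → π A B ≈ 0# ⊎ D ℕ.* (a A ℕ.+ b B) ℕ.≤ D ℕ.+ dist A B) →
    ι D * (𝔼 p a + 𝔼 q b) ⊑ ι D + ∑⊆ (λ A → 𝔼 (π A) (dist A))
  coupling-bound {p = p} {q} {π} {a} {b} {dist} {D} ∑p≈1 π≥0 mˡ mʳ h = begin
    ι D * (𝔼 p a + 𝔼 q b)
      ≈⟨ *-congˡ (+-cong (pushˡ a) pushʳ) ⟨
    ι D * (∑⊆ (λ A → 𝔼 (π A) (λ _ → a A)) + ∑⊆ (λ A → 𝔼 (π A) b))
      ≈⟨ *-congˡ (∑⊆-distrib-+ _ _) ⟨
    ι D * ∑⊆ (λ A → 𝔼 (π A) (λ _ → a A) + 𝔼 (π A) b)
      ≈⟨ *-distribˡ-∑⊆ (ι D) _ ⟩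
    ∑⊆ (λ A → ι D * (𝔼 (π A) (λ _ → a A) + 𝔼 (π A) b))
      ≈⟨ ∑⊆-cong (λ A → *-congˡ (𝔼-+ (π A) (λ _ → a A) b)) ⟨
    ∑⊆ (λ A → ι D * 𝔼 (π A) (λ B → a A ℕ.+ b B))
      ≈⟨ ∑⊆-cong (λ A → 𝔼-scale (π A) D _) ⟨
    ∑⊆ (λ A → 𝔼 (π A) (λ B → D ℕ.* (a A ℕ.+ b B)))
      ≤⟨ ∑⊆-mono (λ A → 𝔼-mono (π≥0 A) (h A)) ⟩
    ∑⊆ (λ A → 𝔼 (π A) (λ B → D ℕ.+ dist A B))
      ≈⟨ ∑⊆-cong (λ A → 𝔼-+ (π A) (λ _ → D) (dist A)) ⟩
    ∑⊆ (λ A → 𝔼 (π A) (λ _ → D) + 𝔼 (π A) (dist A))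
      ≈⟨ ∑⊆-distrib-+ _ _ ⟩
    ∑⊆ (λ A → 𝔼 (π A) (λ _ → D)) + ∑⊆ (λ A → 𝔼 (π A) (dist A))
      ≈⟨ +-congʳ (trans (pushˡ (λ _ → D)) (𝔼-const p ∑p≈1 D)) ⟩
    ι D + ∑⊆ (λ A → 𝔼 (π A) (dist A)) ∎
    where
    pushˡ : ∀ f → ∑⊆ (λ A → 𝔼 (π A) (λ _ → f A)) ≈ 𝔼 p f
    pushˡ f = ∑⊆-cong (λ A → trans (sym (*-distribʳ-∑⊆ (ι (f A)) (π A))) (*-congʳ (mˡ A)))

    pushʳ : ∑⊆ (λ A → 𝔼 (π A) b) ≈ 𝔼 q b
    pushʳ = trans (∑⊆-comm _)
      (∑⊆-cong (λ B → trans (sym (*-distribʳ-∑⊆ (ι (b B)) (λ A → π A B))) (*-congʳ (mʳ B))))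

  -- A nonnegative term is at most the whole sum. It transfers probability zero from a marginal to
  -- the entries of a coupling.
  marginal-0 : ∀ {n} {f : Subset n → Carrier} → (∀ A → 0# ⊑ f A) → ∑⊆ f ≈ 0# → ∀ A → f A ≈ 0#
  marginal-0 {f = f} f≥0 e A = IsPartialOrder.antisym ≼-isPartialOrder
    (≼-trans (term-≼ f f≥0 A) (≼-reflexive e)) (f≥0 A)
    where
    0≼∑ : ∀ {n} (f : Subset n → Carrier) → (∀ A → 0# ⊑ f A) → 0# ⊑ ∑⊆ f
    0≼∑ {n} f f≥0 = ≼-trans (≼-reflexive (sym (∑⊆-0 n))) (∑⊆-mono f≥0)

    term-≼ : ∀ {n} (f : Subset n → Carrier) → (∀ A → 0# ⊑ f A) → ∀ A → f A ⊑ ∑⊆ f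
    term-≼ f f≥0 [] = ≼-reflexive (sym (∑⊆-[] f))
    term-≼ f f≥0 (false ∷ A) = begin
      f (false ∷ A)       ≈⟨ +-identityʳ _ ⟨
      f (false ∷ A) + 0#  ≤⟨ +-mono-≼ (term-≼ _ (λ B → f≥0 (false ∷ B)) A) (0≼∑ _ (λ B → f≥0 (true ∷ B))) ⟩
      ∑⊆ (λ B → f (false ∷ B)) + ∑⊆ (λ B → f (true ∷ B)) ≈⟨ ∑⊆-∷ f ⟨
      ∑⊆ f                ∎
    term-≼ f f≥0 (true ∷ A) = begin
      f (true ∷ A)        ≈⟨ +-identityˡ _ ⟨
      0# + f (true ∷ A)   ≤⟨ +-mono-≼ (0≼∑ _ (λ B → f≥0 (false ∷ B))) (term-≼ _ (λ B → f≥0 (true ∷ B)) A) ⟩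
      ∑⊆ (λ B → f (false ∷ B)) + ∑⊆ (λ B → f (true ∷ B)) ≈⟨ ∑⊆-∷ f ⟨
      ∑⊆ f                ∎

  -- Negation is the identity, matching the trivial negation by which `fromCommutativeSemiring`
  -- presents a semiring to the ring solver.
  ℕ-coefficients : RawRing 0ℓ 0ℓ
  ℕ-coefficients = record
    { Carrier = ℕ ; _≈_ = _≡_ ; _+_ = ℕ._+_ ; _*_ = ℕ._*_ ; -_ = λ m → m ; 0# = 0 ; 1# = 1 }

  ι-homomorphism : ℕ-coefficients -Raw-AlmostCommutative⟶ fromCommutativeSemiring R
  ι-homomorphism = record
    { ⟦_⟧ = ι ; +-homo = ι-+ ; *-homo = ι-* ; -‿homo = λ _ → refl ; 0-homo = ι-zero ; 1-homo = ι-1 }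

  open import Algebra.Solver.Ring ℕ-coefficients (fromCommutativeSemiring R) ι-homomorphism
    (λ a b → Maybe.map (λ e → reflexive (cong ι e)) (dec⇒maybe (a ℕP.≟ b)))
    using (solve; _:=_; con; _:+_; _:*_)

  -- With G the expected number of agreements, 7 * 2kB is at most 8 * (kB + BG). Cancelling 8kB
  -- leaves 6kB on the left and 8BG on the right: a loss of 1/8 of the optimum 2kB is a quarter of
  -- the bonus kB.
  agreement-bound : ∀ {n k} {p : Subset n → Carrier} {a : Fin k → Subset n → ℕ}
    {v : Subset n → ℕ} (α : Carrier) (B : ℕ) .{{_ : ℕ.NonZero B}} →
    ι 8 * α ≈ ι 7 → ∑⊆ p ≈ 1# → (∀ A → 0# ⊑ p A) →
    (∀ A → p A ≈ 0# ⊎ v A ℕ.≤ k ℕ.* B ℕ.+ B ℕ.* sumℕ (λ j → a j A)) →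
    α * ι (2 ℕ.* (k ℕ.* B)) ⊑ 𝔼 p v →
    ι 3 * ι k ⊑ ι 4 * sum (λ j → 𝔼 p (a j))
  agreement-bound {k = k} {p} {a} {v} α B 8α≈7 ∑p≈1 p≥0 v≤ approx =
    ι*-cancel B (ι*-cancel 2 (+-cancelˡ-≼ (ι 8 * (ι k * ι B)) (begin
      ι 8 * (ι k * ι B) + ι 2 * (ι B * (ι 3 * ι k))
        ≈⟨ solve 2 (λ K B → con 8 :* (K :* B) :+ con 2 :* (B :* (con 3 :* K)) :=
                            con 7 :* (con 2 :* (K :* B))) refl (ι k) (ι B) ⟩
      ι 7 * (ι 2 * (ι k * ι B))
        ≈⟨ *-congʳ 8α≈7 ⟨
      ι 8 * α * (ι 2 * (ι k * ι B))
        ≈⟨ *-congˡ (trans (ι-* 2 (k ℕ.* B)) (*-congˡ (ι-* k B))) ⟨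
      ι 8 * α * ι (2 ℕ.* (k ℕ.* B))
        ≈⟨ *-assoc (ι 8) α _ ⟩
      ι 8 * (α * ι (2 ℕ.* (k ℕ.* B)))
        ≤⟨ ι*-mono 8 approx ⟩
      ι 8 * 𝔼 p v
        ≤⟨ ι*-mono 8 (𝔼-mono p≥0 v≤) ⟩
      ι 8 * 𝔼 p (λ A → k ℕ.* B ℕ.+ B ℕ.* sumℕ (λ j → a j A))
        ≈⟨ *-congˡ (𝔼-+ p (λ _ → k ℕ.* B) _) ⟩
      ι 8 * (𝔼 p (λ _ → k ℕ.* B) + 𝔼 p (λ A → B ℕ.* sumℕ (λ j → a j A)))
        ≈⟨ *-congˡ (+-cong (trans (𝔼-const p ∑p≈1 (k ℕ.* B)) (ι-* k B))
             (trans (𝔼-scale p B (λ A → sumℕ (λ j → a j A))) (*-congˡ (𝔼-sum p a)))) ⟩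
      ι 8 * (ι k * ι B + ι B * G)
        ≈⟨ solve 3 (λ K B G → con 8 :* (K :* B :+ B :* G) :=
                              con 8 :* (K :* B) :+ con 2 :* (B :* (con 4 :* G))) refl (ι k) (ι B) G ⟩
      ι 8 * (ι k * ι B) + ι 2 * (ι B * (ι 4 * G)) ∎)))
    where
    G : Carrier
    G = sum (λ j → 𝔼 p (a j))

  -- Let S be the sum of F over all pairs (x, j). Summing `pair` gives 2DS at most 2^k * k * (D +
  -- X), because the flip permutes the targets, while `large` gives 4S at least 3k * 2^k. Hence 6D
  -- is at most 4D + 4X.
  averaging-bound : ∀ {k} .{{_ : ℕ.NonZero k}} {F : Subset k → Fin k → Carrier} {D X} →
    (∀ x j → ι D * (F x j + F (x [ j ]%= not) j) ⊑ ι D + X) →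
    (∀ x → ι 3 * ι k ⊑ ι 4 * sum (F x)) → ι D ⊑ ι 2 * X
  averaging-bound {k} {F} {D} {X} pair large =
    ι*-cancel 2 (+-cancelˡ-≼ (ι 4 * ι D) (ι*-cancel k (ι*-cancel (2 ℕ.^ k) {{ℕP.m^n≢0 2 k}} (begin
      N * (ι k * (ι 4 * ι D + ι 2 * ι D))
        ≈⟨ solve 3 (λ N K D → N :* (K :* (con 4 :* D :+ con 2 :* D)) :=
                              con 2 :* (D :* (N :* (con 3 :* K)))) refl N (ι k) (ι D) ⟩
      ι 2 * (ι D * (N * (ι 3 * ι k)))
        ≈⟨ *-congˡ (*-congˡ (∑⊆-const k (ι 3 * ι k))) ⟨
      ι 2 * (ι D * ∑⊆ {k} (λ _ → ι 3 * ι k))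
        ≤⟨ ι*-mono 2 (ι*-mono D (∑⊆-mono large)) ⟩
      ι 2 * (ι D * ∑⊆ (λ x → ι 4 * sum (F x)))
        ≈⟨ *-congˡ (*-congˡ (*-distribˡ-∑⊆ (ι 4) _)) ⟨
      ι 2 * (ι D * (ι 4 * S))
        ≈⟨ solve 2 (λ D S → con 2 :* (D :* (con 4 :* S)) := con 4 :* (D :* (S :+ S))) refl (ι D) S ⟩
      ι 4 * (ι D * (S + S))
        ≤⟨ ι*-mono 4 twice ⟩
      ι 4 * (N * (ι k * (ι D + X)))
        ≈⟨ solve 4 (λ N K D X → con 4 :* (N :* (K :* (D :+ X))) :=
             N :* (K :* (con 4 :* D :+ con 2 :* (con 2 :* X)))) refl N (ι k) (ι D) X ⟩
      N * (ι k * (ι 4 * ι D + ι 2 * (ι 2 * X))) ∎))))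
    where
    N S : Carrier
    N = ι (2 ℕ.^ k)
    S = ∑⊆ (λ x → sum (F x))

    flipped : ∑⊆ (λ x → sum (λ j → F (x [ j ]%= not) j)) ≈ S
    flipped = trans (∑⊆-sum-comm (λ x j → F (x [ j ]%= not) j))
      (trans (sum-cong (λ j → ∑⊆-flip j (λ x → F x j))) (sym (∑⊆-sum-comm F)))

    twice : ι D * (S + S) ⊑ N * (ι k * (ι D + X))
    twice = begin
      ι D * (S + S)
        ≈⟨ *-congˡ (+-congˡ flipped) ⟨
      ι D * (S + ∑⊆ (λ x → sum (λ j → F (x [ j ]%= not) j)))
        ≈⟨ *-congˡ (∑⊆-distrib-+ _ _) ⟨
      ι D * ∑⊆ (λ x → sum (F x) + sum (λ j → F (x [ j ]%= not) j))
        ≈⟨ *-distribˡ-∑⊆ (ι D) _ ⟩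
      ∑⊆ (λ x → ι D * (sum (F x) + sum (λ j → F (x [ j ]%= not) j)))
        ≈⟨ ∑⊆-cong (λ x → trans
             (*-congˡ (sym (∑-distrib-+ (F x) (λ j → F (x [ j ]%= not) j))))
             (*-distribˡ-sum (ι D) (λ j → F x j + F (x [ j ]%= not) j))) ⟩
      ∑⊆ (λ x → sum (λ j → ι D * (F x j + F (x [ j ]%= not) j)))
        ≤⟨ ∑⊆-mono (λ x → sum-mono (pair x)) ⟩
      ∑⊆ {k} (λ _ → sum {k} (λ _ → ι D + X))
        ≈⟨ ∑⊆-const k _ ⟩
      N * sum {k} (λ _ → ι D + X)
        ≈⟨ *-congˡ (sum-const k (ι D + X)) ⟩
      N * (ι k * (ι D + X)) ∎

  -- The bound on b reads b ≤ 4aK, so ρ ≤ 4K after cancelling a; c plays the part of 1/4.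
  rescale : ∀ {c ρ K a b} .{{_ : ℕ.NonZero a}} → ι 4 * c ≈ 1# →
    ι a * ρ ⊑ ι b → ι b ⊑ ι 2 * (K * ι (2 ℕ.* a)) → c * ρ ⊑ K
  rescale {c} {ρ} {K} {a} {b} 4c≈1 aρ≼b b≼ = ι*-cancel 4 (ι*-cancel a (begin
    ι a * (ι 4 * (c * ρ))       ≈⟨ *-congˡ (trans (sym (*-assoc (ι 4) c ρ)) (trans (*-congʳ 4c≈1) (*-identityˡ ρ))) ⟩
    ι a * ρ                     ≤⟨ aρ≼b ⟩
    ι b                         ≤⟨ b≼ ⟩
    ι 2 * (K * ι (2 ℕ.* a))     ≈⟨ *-congˡ (*-congˡ (ι-* 2 a)) ⟩
    ι 2 * (K * (ι 2 * ι a))     ≈⟨ solve 2 (λ K a → con 2 :* (K :* (con 2 :* a)) := a :* (con 4 :* K)) refl K (ι a) ⟩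
    ι a * (ι 4 * K)             ∎))

  -- An infimum over couplings is known only through its lower bounds. The bound from
  -- `coupling-bound` is the same for all couplings, so the hypothesis on l applies to it once D has
  -- been subtracted.
  lipschitz-bound : ∀ {n k D B} .{{_ : ℕ.NonZero k}} .{{_ : ℕ.NonZero B}} {α c ρ K}
    (p : Subset k → Subset n → C) → (∀ x A → 0ᶜ ≼ p x A) → (∀ x → ∑⊆ (p x) ≃ 1ᶜ) →
    (Feasible : Subset n → Set) → (∀ A → Dec (Feasible A)) → (∀ x A → ¬ Feasible A → p x A ≃ 0ᶜ) →
    (a : Subset k → Fin k → Subset n → ℕ) (v : Subset k → Subset n → ℕ) →
    (∀ x A → Feasible A → v x A ℕ.≤ k ℕ.* B ℕ.+ B ℕ.* sumℕ (λ j → a x j A)) →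
    (∀ x → (α ⊗ ι (2 ℕ.* (k ℕ.* B))) ≼ ∑⊆ (λ A → p x A ⊗ ι (v x A))) →
    (dist : Subset k → Fin k → Subset n → Subset n → ℕ) →
    (∀ x j A A′ → Feasible A → Feasible A′ →
      D ℕ.* (a x j A ℕ.+ a (x [ j ]%= not) j A′) ℕ.≤ D ℕ.+ dist x j A A′) →
    (∀ x j l → (∀ (π : Subset n → Subset n → C) → (∀ A A′ → 0ᶜ ≼ π A A′) →
        (∀ A → ∑⊆ (λ A′ → π A A′) ≃ p x A) → (∀ A′ → ∑⊆ (λ A → π A A′) ≃ p (x [ j ]%= not) A′) →
        l ≼ ∑⊆ (λ A → ∑⊆ (λ A′ → π A A′ ⊗ ι (dist x j A A′)))) →
      l ≼ (K ⊗ ι (2 ℕ.* B))) →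
    (ι 8 ⊗ α) ≃ ι 7 → (ι 4 ⊗ c) ≃ 1ᶜ → (ι B ⊗ ρ) ≼ ι D → (c ⊗ ρ) ≼ K
  lipschitz-bound {n} {k} {D} {B} {α} {c} {ρ} {K} p p≥0 ∑p≈1 Feasible feasible? support
    a v v≤ approx dist separated EM≤ 8α≈7 4c≈1 ρ≼ =
    rescale 4c≈1 ρ≼ (averaging-bound {F = F} pair
      (λ x → agreement-bound {a = a x} α B 8α≈7 (∑p≈1 x) (p≥0 x) (v-supported x) (approx x)))
    where
    F : Subset k → Fin k → Carrier
    F x j = 𝔼 (p x) (a x j)

    v-supported : ∀ x A → p x A ≈ 0# ⊎ v x A ℕ.≤ k ℕ.* B ℕ.+ B ℕ.* sumℕ (λ j → a x j A)
    v-supported x A with feasible? A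
    ... | yes A-feasible = inj₂ (v≤ x A A-feasible)
    ... | no  A-infeasible = inj₁ (support x A A-infeasible)

    pair : ∀ x j → ι D * (F x j + F (x [ j ]%= not) j) ⊑ ι D + K * ι (2 ℕ.* B)
    pair x j = begin
      L                    ≈⟨ x-y+y≈x L (ι D) ⟨
      (L - ι D) + ι D      ≤⟨ +-mono-≼ (EM≤ x j (L - ι D) lower) ≼-refl ⟩
      K * ι (2 ℕ.* B) + ι D  ≈⟨ +-comm _ _ ⟩
      ι D + K * ι (2 ℕ.* B)  ∎
      where
      L : Carrier
      L = ι D * (F x j + F (x [ j ]%= not) j)

      lower : ∀ π → (∀ A A′ → 0# ⊑ π A A′) →
        (∀ A → ∑⊆ (λ A′ → π A A′) ≈ p x A) → (∀ A′ → ∑⊆ (λ A → π A A′) ≈ p (x [ j ]%= not) A′) →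
        L - ι D ⊑ ∑⊆ (λ A → ∑⊆ (λ A′ → π A A′ * ι (dist x j A A′)))
      lower π π≥0 mˡ mʳ = +-cancelˡ-≼ (ι D) (begin
        ι D + (L - ι D)  ≈⟨ +-comm _ _ ⟩
        (L - ι D) + ι D  ≈⟨ x-y+y≈x L (ι D) ⟩
        L                ≤⟨ coupling-bound (∑p≈1 x) π≥0 mˡ mʳ supported ⟩
        ι D + ∑⊆ (λ A → ∑⊆ (λ A′ → π A A′ * ι (dist x j A A′))) ∎)
        where
        -- Decidability of feasibility matters here: either both outcomes are solutions, or one has
        -- probability zero and so does the pair.
        supported : ∀ A A′ → π A A′ ≈ 0# ⊎
          D ℕ.* (a x j A ℕ.+ a (x [ j ]%= not) j A′) ℕ.≤ D ℕ.+ dist x j A A′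
        supported A A′ with feasible? A | feasible? A′
        ... | no ¬f | _ = inj₁ (marginal-0 (π≥0 A) (trans (mˡ A) (support x A ¬f)) A′)
        ... | yes _ | no ¬f = inj₁ (marginal-0 (λ A → π≥0 A A′) (trans (mʳ A′) (support (x [ j ]%= not) A′ ¬f)) A)
        ... | yes f | yes f′ = inj₂ (separated x j A A′ f f′)

-- The order and the semiring structure of ℝ

open import Defs
open CauchyLemmas
open RootLemmas

-- `_≤_` and `_≈_` unfold to statements about sequences, from which Agda cannot
-- recover the reals; the wrapped relations determine their arguments.
infix 4 _≼_ _≋_

record _≼_ (x y : ℝ) : Set where
  constructor wrap
  field unwrap : x ≤ y

open _≼_

record _≋_ (x y : ℝ) : Set where
  constructor antisym
  field
    to   : x ≼ y
    from : y ≼ x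

open _≋_

wrap≈ : ∀ {x y} → x ≈ y → x ≋ y
wrap≈ (p , q) = antisym (wrap p) (wrap q)

unwrap≈ : ∀ {x y} → x ≋ y → x ≈ y
unwrap≈ (antisym p q) = unwrap p , unwrap q

pointwise-≼ : ∀ {x y} → (∀ n → seq x n ℚ.≤ seq y n) → x ≼ y
pointwise-≼ {x} {y} p .unwrap η η>0 = 0 , λ n _ → ℚP.≤-trans (p n)
  (subst (ℚ._≤ seq y n ℚ.+ η) (ℚP.+-identityʳ (seq y n))
    (ℚP.+-monoʳ-≤ (seq y n) (ℚP.<⇒≤ η>0)))

pointwise : ∀ {x y} → (∀ n → seq x n ≡ seq y n) → x ≋ y
pointwise p = antisym (pointwise-≼ λ n → ℚP.≤-reflexive (p n))
                      (pointwise-≼ λ n → ℚP.≤-reflexive (≡.sym (p n)))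

≼-refl : ∀ {x} → x ≼ x
≼-refl = pointwise-≼ λ _ → ℚP.≤-refl

≼-trans : ∀ {x y z} → x ≼ y → y ≼ z → x ≼ z
≼-trans {x} {y} {z} (wrap p) (wrap q) .unwrap η η>0 =
  let M , p′ = p (ℚ.½ ℚ.* η) (half η η>0)
      N , q′ = q (ℚ.½ ℚ.* η) (half η η>0)
  in M ℕ.⊔ N , λ n n≥ → begin
    seq x n                                     ≤⟨ p′ n (≤⊔ˡ n≥) ⟩
    seq y n ℚ.+ ℚ.½ ℚ.* η                       ≤⟨ ℚP.+-monoˡ-≤ (ℚ.½ ℚ.* η) (q′ n (≤⊔ʳ n≥)) ⟩
    seq z n ℚ.+ ℚ.½ ℚ.* η ℚ.+ ℚ.½ ℚ.* η         ≡⟨ ℚP.+-assoc (seq z n) _ _ ⟩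
    seq z n ℚ.+ (ℚ.½ ℚ.* η ℚ.+ ℚ.½ ℚ.* η)       ≡⟨ cong (seq z n ℚ.+_) (half+half η) ⟩
    seq z n ℚ.+ η                               ∎
  where open ℚP.≤-Reasoning

+-mono-≼ : ∀ {x y z w} → x ≼ y → z ≼ w → x + z ≼ y + w
+-mono-≼ {x} {y} {z} {w} (wrap p) (wrap q) .unwrap η η>0 =
  let M , p′ = p (ℚ.½ ℚ.* η) (half η η>0)
      N , q′ = q (ℚ.½ ℚ.* η) (half η η>0)
  in M ℕ.⊔ N , λ n n≥ → subst (seq x n ℚ.+ seq z n ℚ.≤_)
       (≡.trans (regroup (seq y n) (ℚ.½ ℚ.* η) (seq w n) (ℚ.½ ℚ.* η))
         (cong (seq y n ℚ.+ seq w n ℚ.+_) (half+half η)))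
       (ℚP.+-mono-≤ (p′ n (≤⊔ˡ n≥)) (q′ n (≤⊔ʳ n≥)))
  where
  open +-*-Solver
  regroup : ∀ a b c d → a ℚ.+ b ℚ.+ (c ℚ.+ d) ≡ a ℚ.+ c ℚ.+ (b ℚ.+ d)
  regroup = solve 4 (λ a b c d → a :+ b :+ (c :+ d) := a :+ c :+ (b :+ d)) ≡.refl

≋-refl : ∀ {x} → x ≋ x
≋-refl = antisym ≼-refl ≼-refl

≋-sym : ∀ {x y} → x ≋ y → y ≋ x
≋-sym (antisym p q) = antisym q p

≋-trans : ∀ {x y z} → x ≋ y → y ≋ z → x ≋ z
≋-trans (antisym p q) (antisym p′ q′) = antisym (≼-trans p p′) (≼-trans q′ q)

≋-isEquivalence : IsEquivalence _≋_
≋-isEquivalence = record { refl = ≋-refl ; sym = ≋-sym ; trans = ≋-trans }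

+-cong : ∀ {x y z w} → x ≋ y → z ≋ w → x + z ≋ y + w
+-cong (antisym p q) (antisym p′ q′) = antisym (+-mono-≼ p p′) (+-mono-≼ q q′)

-- The factor z may have any sign, so the error is bounded by |x - y| * |z|: an eventual bound B on
-- |z| turns the tolerance η into ζ with Bζ = η, and both halves of `x ≋ y` are needed to control |x
-- - y|.
*-congʳ-≼ : ∀ {x y} z → x ≋ y → x * z ≼ y * z
*-congʳ-≼ {x} {y} z (antisym (wrap p) (wrap q)) .unwrap η η>0 =
  let B , B>0 , L , b  = eventually-bounded {seq z} (cauchy z)
      ζ , ζ>0 , Bζ≡η  = divide B η B>0 η>0
      M , p′           = p ζ ζ>0
      N , q′           = q ζ ζ>0
  in L ℕ.⊔ (M ℕ.⊔ N) , λ n n≥ →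
    let X = seq x n ; Y = seq y n ; Z = seq z n
        M⊔N≤n = ≤⊔ʳ {L} {M ℕ.⊔ N} n≥
    in begin
    X ℚ.* Z
      ≡⟨ split X Y Z ⟩
    Y ℚ.* Z ℚ.+ (X ℚ.- Y) ℚ.* Z
      ≤⟨ ℚP.+-monoʳ-≤ (Y ℚ.* Z) (p≤∣p∣ ((X ℚ.- Y) ℚ.* Z)) ⟩
    Y ℚ.* Z ℚ.+ ℚ.∣ (X ℚ.- Y) ℚ.* Z ∣
      ≡⟨ cong (Y ℚ.* Z ℚ.+_) (ℚP.∣p*q∣≡∣p∣*∣q∣ (X ℚ.- Y) Z) ⟩
    Y ℚ.* Z ℚ.+ ℚ.∣ X ℚ.- Y ∣ ℚ.* ℚ.∣ Z ∣
      ≤⟨ ℚP.+-monoʳ-≤ (Y ℚ.* Z) (mono-* (ℚP.0≤∣p∣ (X ℚ.- Y))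
           (∣-∣-bound {X} {Y} (a≤b+c⇒a-b≤c {X} {Y} (p′ n (≤⊔ˡ {M} {N} M⊔N≤n)))
             (a≤b+c⇒a-b≤c {Y} {X} (q′ n (≤⊔ʳ {M} {N} M⊔N≤n))))
           (ℚP.<⇒≤ B>0) (b n (≤⊔ˡ {L} {M ℕ.⊔ N} n≥))) ⟩
    Y ℚ.* Z ℚ.+ ζ ℚ.* B
      ≡⟨ cong (Y ℚ.* Z ℚ.+_) (≡.trans (ℚP.*-comm ζ B) Bζ≡η) ⟩
    Y ℚ.* Z ℚ.+ η ∎
  where
  open ℚP.≤-Reasoning
  p≤∣p∣ : ∀ p → p ℚ.≤ ℚ.∣ p ∣
  p≤∣p∣ p with ℚP.≤-total 0ℚ p
  ... | inj₁ 0≤p = ℚP.≤-reflexive (≡.sym (ℚP.0≤p⇒∣p∣≡p 0≤p))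
  ... | inj₂ p≤0 = ℚP.≤-trans p≤0 (ℚP.0≤∣p∣ p)

  split : ∀ a b c → a ℚ.* c ≡ b ℚ.* c ℚ.+ (a ℚ.- b) ℚ.* c
  split = solve 3 (λ a b c → a :* c := b :* c :+ (a :- b) :* c) ≡.refl
    where open +-*-Solver

*-comm : ∀ x y → x * y ≋ y * x
*-comm x y = pointwise λ n → ℚP.*-comm (seq x n) (seq y n)

*-cong : ∀ {x y z w} → x ≋ y → z ≋ w → x * z ≋ y * w
*-cong {x} {y} {z} {w} p q = ≋-trans {x * z} {y * z} {y * w} (congʳ {x} {y} z p)
  (≋-trans {y * z} {z * y} {y * w} (*-comm y z)
    (≋-trans {z * y} {w * y} {y * w} (congʳ {z} {w} y q) (*-comm w y)))
  where
  congʳ : ∀ {x y} z → x ≋ y → x * z ≋ y * z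
  congʳ {x} {y} z p = antisym {x * z} {y * z} (*-congʳ-≼ {x} {y} z p) (*-congʳ-≼ {y} {x} z (≋-sym {x} {y} p))

ℝ-isCommutativeSemiring : IsCommutativeSemiring _≋_ _+_ _*_ 0ℝ 1ℝ
ℝ-isCommutativeSemiring = record
  { isSemiring = record
    { isSemiringWithoutAnnihilatingZero = record
      { +-isCommutativeMonoid = record
        { isMonoid = record
          { isSemigroup = record
            { isMagma = record { isEquivalence = ≋-isEquivalence ; ∙-cong = +-cong }
            ; assoc = λ x y z → pointwise λ n → ℚP.+-assoc (seq x n) (seq y n) (seq z n)
            }
          ; identity = (λ x → pointwise λ n → ℚP.+-identityˡ (seq x n))
                     , (λ x → pointwise λ n → ℚP.+-identityʳ (seq x n))
          }
        ; comm = λ x y → pointwise λ n → ℚP.+-comm (seq x n) (seq y n)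
        }
      ; *-cong = *-cong
      ; *-assoc = λ x y z → pointwise λ n → ℚP.*-assoc (seq x n) (seq y n) (seq z n)
      ; *-identity = (λ x → pointwise λ n → ℚP.*-identityˡ (seq x n))
                   , (λ x → pointwise λ n → ℚP.*-identityʳ (seq x n))
      ; distrib = (λ x y z → pointwise λ n → ℚP.*-distribˡ-+ (seq x n) (seq y n) (seq z n))
                , (λ x y z → pointwise λ n → ℚP.*-distribʳ-+ (seq x n) (seq y n) (seq z n))
      }
    ; zero = (λ x → pointwise λ n → ℚP.*-zeroˡ (seq x n))
           , (λ x → pointwise λ n → ℚP.*-zeroʳ (seq x n))
    }
  ; *-comm = *-comm
  }

≼-isPartialOrder : IsPartialOrder _≋_ _≼_
≼-isPartialOrder = record
  { isPreorder = record
    { isEquivalence = ≋-isEquivalence ; reflexive = to ; trans = ≼-trans }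
  ; antisym = antisym
  }

x-y+y≋x : ∀ x y → x - y + y ≋ x
x-y+y≋x x y = pointwise λ n → ≡.sym (sub-add (seq x n) (seq y n))

+-cancelˡ-≼ : ∀ z {x y} → z + x ≼ z + y → x ≼ y
+-cancelˡ-≼ z {x} {y} (wrap p) .unwrap η η>0 = let N , h = p η η>0 in
  N , λ n n≥ → subst₂ ℚ._≤_ (cancel (seq z n) (seq x n)) (cancel′ (seq z n) (seq y n) η)
    (ℚP.+-monoʳ-≤ (ℚ.- seq z n) (h n n≥))
  where
  open +-*-Solver
  cancel : ∀ a b → ℚ.- a ℚ.+ (a ℚ.+ b) ≡ b
  cancel = solve 2 (λ a b → :- a :+ (a :+ b) := b) ≡.refl
  cancel′ : ∀ a b c → ℚ.- a ℚ.+ (a ℚ.+ b ℚ.+ c) ≡ b ℚ.+ c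
  cancel′ = solve 3 (λ a b c → :- a :+ (a :+ b :+ c) := b :+ c) ≡.refl

seq-sum-const : ∀ m x n → seq (sum {m} (λ _ → x)) n ≡ + m ℚ./ 1 ℚ.* seq x n
seq-sum-const zero    x n = ≡.sym (ℚP.*-zeroˡ (seq x n))
seq-sum-const (suc m) x n = ≡.trans (cong (seq x n ℚ.+_) (seq-sum-const m x n))
  (≡.trans (collect (seq x n) (+ m ℚ./ 1)) (cong (ℚ._* seq x n) (≡.sym (frac-suc m 0))))
  where
  collect : ∀ a b → a ℚ.+ b ℚ.* a ≡ (b ℚ.+ 1ℚ) ℚ.* a
  collect a b = ≡.trans (ℚP.+-comm a (b ℚ.* a)) (≡.trans
    (cong (b ℚ.* a ℚ.+_) (≡.sym (ℚP.*-identityˡ a))) (≡.sym (ℚP.*-distribʳ-+ a b 1ℚ)))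

-- The factor c is at least 1, so the tolerance η is at most cη and c can be cancelled throughout.
sum-const-cancel : ∀ m {x y} → sum {suc m} (λ _ → x) ≼ sum {suc m} (λ _ → y) → x ≼ y
sum-const-cancel m {x} {y} (wrap p) .unwrap η η>0 = let N , h = p η η>0 in
  N , λ n n≥ → ℚP.*-cancelˡ-≤-pos c {{c-pos}} (begin
    c ℚ.* seq x n                      ≡⟨ seq-sum-const (suc m) x n ⟨
    seq (sum {suc m} (λ _ → x)) n      ≤⟨ h n n≥ ⟩
    seq (sum {suc m} (λ _ → y)) n ℚ.+ η ≡⟨ cong (ℚ._+ η) (seq-sum-const (suc m) y n) ⟩
    c ℚ.* seq y n ℚ.+ η                ≡⟨ cong (c ℚ.* seq y n ℚ.+_) (ℚP.*-identityˡ η) ⟨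
    c ℚ.* seq y n ℚ.+ 1ℚ ℚ.* η         ≤⟨ ℚP.+-monoʳ-≤ (c ℚ.* seq y n)
                                    (ℚP.*-monoʳ-≤-nonNeg η {{ℚ.nonNegative (ℚP.<⇒≤ η>0)}} 1≤c) ⟩
    c ℚ.* seq y n ℚ.+ c ℚ.* η          ≡⟨ ℚP.*-distribˡ-+ c (seq y n) η ⟨
    c ℚ.* (seq y n ℚ.+ η)              ∎)
  where
  open ℚP.≤-Reasoning
  c : ℚ
  c = + suc m ℚ./ 1

  1≤c : 1ℚ ℚ.≤ c
  1≤c = frac-≤ 1 0 (suc m) 0 (ℕ.s≤s ℕ.z≤n)

  c-pos : ℚ.Positive c
  c-pos = ℚ.positive (ℚP.<-≤-trans 0<1 1≤c)

-- `sum` behind a definition, which keeps it folded when it is passed to `SubsetSums`.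
∑ : ∀ {n} → (Fin n → ℝ) → ℝ
∑ f = sum f

-- These hold definitionally, but checking that directly compares the proofs of
-- the Cauchy property.
sum-zero : (f : Fin 0 → ℝ) → ∑ f ≋ 0ℝ
sum-zero f = pointwise λ n → ≡.refl

sum-suc : ∀ {n} (f : Fin (suc n) → ℝ) → ∑ f ≋ f zero + ∑ (λ i → f (suc i))
sum-suc f = pointwise λ n → ≡.refl

∑⊆-[] : (f : Subset 0 → ℝ) → ∑⊆ f ≋ f []
∑⊆-[] f = pointwise λ n → ≡.refl

∑⊆-∷ : ∀ {n} (f : Subset (suc n) → ℝ) →
  ∑⊆ f ≋ ∑⊆ (λ A → f (outside ∷ A)) + ∑⊆ (λ A → f (inside ∷ A))
∑⊆-∷ f = pointwise λ n → ≡.refl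

ι : ℕ → ℝ
ι m = fromℚ (+ m ℚ./ 1)

ι-zero : ι 0 ≋ 0ℝ
ι-zero = pointwise λ _ → ≡.refl

ι-suc : ∀ m → ι (suc m) ≋ 1ℝ + ι m
ι-suc m = pointwise λ _ → ≡.trans (frac-suc m 0) (ℚP.+-comm (+ m ℚ./ 1) 1ℚ)

ℝ-isOrderedSemiring : IsOrderedSemiring _≋_ _≼_ _+_ _*_ _-_ 0ℝ 1ℝ ι ∑ ∑⊆
ℝ-isOrderedSemiring = record
  { isCommutativeSemiring = ℝ-isCommutativeSemiring
  ; ≼-isPartialOrder = ≼-isPartialOrder
  ; +-mono-≼ = λ {x} {y} {z} {w} → +-mono-≼ {x} {y} {z} {w}
  ; +-cancelˡ-≼ = λ z {x} {y} → +-cancelˡ-≼ z {x} {y}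
  ; x-y+y≈x = x-y+y≋x
  ; ι-zero = ι-zero
  ; ι-suc = ι-suc
  ; sum-zero = sum-zero
  ; sum-suc = sum-suc
  ; sum-const-cancel = λ m {x} {y} → sum-const-cancel m {x} {y}
  ; ∑⊆-[] = ∑⊆-[]
  ; ∑⊆-∷ = ∑⊆-∷
  }

module 𝕊 = SubsetSums _≋_ _≼_ _+_ _*_ _-_ 0ℝ 1ℝ ι ∑ ∑⊆ ℝ-isOrderedSemiring

-- Reals with natural values, and bounds on roots

frac-+ : ∀ a b → + (a ℕ.+ b) ℚ./ 1 ≡ + a ℚ./ 1 ℚ.+ + b ℚ./ 1
frac-+ zero    b = ≡.sym (ℚP.+-identityˡ _)
frac-+ (suc a) b = ≡.trans (frac-suc (a ℕ.+ b) 0) (≡.trans (cong (ℚ._+ 1ℚ) (frac-+ a b))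
  (≡.trans (swap (+ a ℚ./ 1) (+ b ℚ./ 1)) (cong (ℚ._+ + b ℚ./ 1) (≡.sym (frac-suc a 0)))))
  where
  open +-*-Solver
  swap : ∀ x y → x ℚ.+ y ℚ.+ 1ℚ ≡ x ℚ.+ 1ℚ ℚ.+ y
  swap x y = solve 3 (λ x y z → x :+ y :+ z := x :+ z :+ y) ≡.refl x y 1ℚ

0≤frac : ∀ a k → 0ℚ ℚ.≤ + a ℚ./ suc k
0≤frac a k = frac-≤ 0 0 a k ℕ.z≤n

∣frac-frac∣-≤ : ∀ {a b} → a ℕ.≤ b → ℚ.∣ + b ℚ./ 1 ℚ.- + a ℚ./ 1 ∣ ≡ + (b ℕ.∸ a) ℚ./ 1
∣frac-frac∣-≤ {a} {b} a≤b = ≡.trans (cong ℚ.∣_∣ difference) (ℚP.0≤p⇒∣p∣≡p (0≤frac (b ℕ.∸ a) 0))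
  where
  open +-*-Solver
  difference : + b ℚ./ 1 ℚ.- + a ℚ./ 1 ≡ + (b ℕ.∸ a) ℚ./ 1
  difference = ≡.trans
    (cong (ℚ._- + a ℚ./ 1) (≡.trans (cong (λ m → + m ℚ./ 1) (≡.sym (ℕP.m∸n+n≡m a≤b))) (frac-+ (b ℕ.∸ a) a)))
    (solve 2 (λ x y → x :+ y :- y := x) ≡.refl (+ (b ℕ.∸ a) ℚ./ 1) (+ a ℚ./ 1))

∣frac-frac∣ : ∀ a b → ℚ.∣ + a ℚ./ 1 ℚ.- + b ℚ./ 1 ∣ ≡ + ℕ.∣ a - b ∣ ℚ./ 1
∣frac-frac∣ a b with ℕP.≤-total a b
... | inj₁ a≤b = ≡.trans (∣-∣-swap (+ a ℚ./ 1) (+ b ℚ./ 1))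
  (≡.trans (∣frac-frac∣-≤ a≤b) (cong (λ d → + d ℚ./ 1) (≡.sym (ℕP.m≤n⇒∣m-n∣≡n∸m a≤b))))
... | inj₂ b≤a = ≡.trans (∣frac-frac∣-≤ b≤a)
  (cong (λ d → + d ℚ./ 1) (≡.sym (≡.trans (ℕP.∣-∣-comm a b) (ℕP.m≤n⇒∣m-n∣≡n∸m b≤a))))

-- Equality with a natural number at every index, not only in the limit. It passes through sums and
-- absolute differences by rational computation alone, without estimates.
record _≐_ (x : ℝ) (m : ℕ) : Set where
  constructor value
  field seq≡ : ∀ n → seq x n ≡ + m ℚ./ 1

open _≐_

≐⇒≋ : ∀ {x m} → x ≐ m → x ≋ ι m
≐⇒≋ e = pointwise (seq≡ e)

≐-+ : ∀ {x y a b} → x ≐ a → y ≐ b → (x + y) ≐ (a ℕ.+ b)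
≐-+ {x} {y} {a} {b} p q = value λ n →
  ≡.trans (≡.cong₂ ℚ._+_ (seq≡ p n) (seq≡ q n)) (≡.sym (frac-+ a b))

≐-∣-∣ : ∀ {x y a b} → x ≐ a → y ≐ b → ∣ x - y ∣ ≐ ℕ.∣ a - b ∣
≐-∣-∣ {x} {y} {a} {b} p q = value λ n →
  ≡.trans (≡.cong₂ (λ r s → ℚ.∣ r ℚ.- s ∣) (seq≡ p n) (seq≡ q n)) (∣frac-frac∣ a b)

≐-sum : ∀ {n} {f : Fin n → ℝ} {g : Fin n → ℕ} → (∀ i → f i ≐ g i) → sum f ≐ sumℕ g
≐-sum {zero}  p = value λ _ → ≡.refl
≐-sum {suc n} {f} {g} p = value λ m → ≡.trans
  (≡.cong₂ ℚ._+_ (seq≡ (p zero) m) (seq≡ (≐-sum (λ i → p (suc i))) m))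
  (≡.sym (frac-+ (g zero) (sumℕ (λ i → g (suc i)))))

≐-∑∈ : ∀ {n} (A : Subset n) {f : Fin n → ℝ} {g : Fin n → ℕ} → (∀ i → f i ≐ g i) →
  ∑∈ A f ≐ sumℕ (λ i → if lookup A i then g i else 0)
≐-∑∈ A {f} {g} p = ≐-sum term
  where
  term : ∀ i → (if lookup A i then f i else 0ℝ) ≐ (if lookup A i then g i else 0)
  term i with lookup A i
  ... | true  = p i
  ... | false = value λ _ → ≡.refl

0≼ι : ∀ m → 0ℝ ≼ ι m
0≼ι m = pointwise-≼ λ n → 0≤frac m 0

ι-mono : ∀ {a b} → a ℕ.≤ b → ι a ≼ ι b
ι-mono {a} {b} a≤b = pointwise-≼ λ _ → frac-≤ a 0 b 0 (ℕP.*-monoˡ-≤ 1 a≤b)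

ι-injective : ∀ {a b} → ι a ≋ ι b → a ≡ b
ι-injective p = ℕP.≤-antisym (reflect (to p)) (reflect (from p))
  where
  reflect : ∀ {a b} → ι a ≼ ι b → a ℕ.≤ b
  reflect {a} {b} p = ℕP.≮⇒≥ λ b<a →
    -- Any tolerance below 1 separates distinct naturals: b + 1 ≤ a ≤ b + 1/2 is absurd.
    let N , h = unwrap p ℚ.½ (ℚP.positive⁻¹ ℚ.½) in
    1≰½ (+-cancel-≤ (+ b ℚ./ 1) (ℚP.≤-trans
      (subst (ℚ._≤ + a ℚ./ 1) (frac-suc b 0)
        (frac-≤ (suc b) 0 a 0 (ℕP.*-monoˡ-≤ 1 b<a))) (h N ℕP.≤-refl)))
    where
    1≰½ : ¬ (1ℚ ℚ.≤ ℚ.½)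
    1≰½ (ℚ.*≤* (ℤ.+≤+ (ℕ.s≤s ())))

    +-cancel-≤ : ∀ p {q r} → p ℚ.+ q ℚ.≤ p ℚ.+ r → q ℚ.≤ r
    +-cancel-≤ p {q} {r} h = subst₂ ℚ._≤_ (cancel p q) (cancel p r) (ℚP.+-monoʳ-≤ (ℚ.- p) h)
      where
      open +-*-Solver
      cancel : ∀ a b → ℚ.- a ℚ.+ (a ℚ.+ b) ≡ b
      cancel = solve 2 (λ a b → :- a :+ (a :+ b) := b) ≡.refl

frac-cancel : ∀ a b → + suc a ℚ./ 1 ℚ.* (+ b ℚ./ suc a) ≡ + b ℚ./ 1
frac-cancel a b = ℚP.toℚᵘ-injective (begin
  ℚ.toℚᵘ (+ suc a ℚ./ 1 ℚ.* (+ b ℚ./ suc a))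
    ≈⟨ ℚP.toℚᵘ-homo-* (+ suc a ℚ./ 1) (+ b ℚ./ suc a) ⟩
  ℚ.toℚᵘ (+ suc a ℚ./ 1) ℚᵘ.* ℚ.toℚᵘ (+ b ℚ./ suc a)
    ≈⟨ ℚᵘP.*-cong (toℚᵘ-/ (suc a) 0) (toℚᵘ-/ b a) ⟩
  ℚᵘ.mkℚᵘ (+ suc a) 0 ℚᵘ.* ℚᵘ.mkℚᵘ (+ b) a
    ≈⟨ ℚᵘ.*≡* (cong-numerators) ⟩
  ℚᵘ.mkℚᵘ (+ b) 0
    ≈⟨ toℚᵘ-/ b 0 ⟨
  ℚ.toℚᵘ (+ b ℚ./ 1) ∎)
  where
  open ℚᵘP.≃-Reasoning
  cong-numerators : (+ suc a ℤ.* + b) ℤ.* + 1 ≡ + b ℤ.* + (1 ℕ.* suc a)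
  cong-numerators = ≡.trans (ℤP.*-identityʳ _) (≡.trans (ℤP.*-comm (+ suc a) (+ b))
    (cong (λ d → + b ℤ.* + d) (≡.sym (ℕP.*-identityˡ (suc a)))))

-- The approximants round down, so each of them, not only the limit, lies below b / (a + 1). After
-- clearing denominators the comparison is made between q-th powers.
rootSeq-≤frac : ∀ q .{{_ : ℕ.NonZero q}} {m b} a → m ℕ.* suc a ℕ.^ q ℕ.≤ b ℕ.^ q →
  ∀ k → rootSeq q m k ℚ.≤ + b ℚ./ suc a
rootSeq-≤frac q {m} {b} a h k = frac-≤ r k b a (ℕP.≮⇒≥ λ lt →
  ℕP.<⇒≱ (ℕP.^-monoˡ-< q lt) powers)
  where
  open ℕP.≤-Reasoning
  r : ℕ
  r = iroot q (m ℕ.* suc k ℕ.^ q)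

  powers : (r ℕ.* suc a) ℕ.^ q ℕ.≤ (b ℕ.* suc k) ℕ.^ q
  powers = begin
    (r ℕ.* suc a) ℕ.^ q                   ≡⟨ ^-distribʳ-* q r (suc a) ⟩
    r ℕ.^ q ℕ.* suc a ℕ.^ q               ≤⟨ ℕP.*-monoˡ-≤ (suc a ℕ.^ q) (iroot≤-lower q M M) ⟩
    m ℕ.* suc k ℕ.^ q ℕ.* suc a ℕ.^ q       ≡⟨ Algebra.Properties.CommutativeSemigroup.xy∙z≈xz∙y ℕP.*-commutativeSemigroup m _ _ ⟩
    m ℕ.* suc a ℕ.^ q ℕ.* suc k ℕ.^ q       ≤⟨ ℕP.*-monoˡ-≤ (suc k ℕ.^ q) h ⟩
    b ℕ.^ q ℕ.* suc k ℕ.^ q                 ≡⟨ ^-distribʳ-* q b (suc k) ⟨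
    (b ℕ.* suc k) ℕ.^ q                     ∎
    where
    M : ℕ
    M = m ℕ.* suc k ℕ.^ q

ι*root-≼ : ∀ q .{{_ : ℕ.NonZero q}} {m b} a .{{_ : ℕ.NonZero a}} →
  m ℕ.* a ℕ.^ q ℕ.≤ b ℕ.^ q → ι a * root q m ≼ ι b
ι*root-≼ q {m} {b} (suc a) h = pointwise-≼ λ k → subst (+ suc a ℚ./ 1 ℚ.* rootSeq q m k ℚ.≤_)
  (frac-cancel a b)
  (ℚP.*-monoˡ-≤-nonNeg (+ suc a ℚ./ 1) {{ℚ.nonNegative (0≤frac (suc a) 0)}} (rootSeq-≤frac q {m} {b} a h k))

-- The code and its formula

sumℕ-mono : ∀ {n} {f g : Fin n → ℕ} → (∀ i → f i ℕ.≤ g i) → sumℕ f ℕ.≤ sumℕ g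
sumℕ-mono {zero}  p = ℕ.z≤n
sumℕ-mono {suc n} p = ℕP.+-mono-≤ (p zero) (sumℕ-mono (p ∘ suc))

sumℕ-const : ∀ n c → sumℕ {n} (λ _ → c) ≡ n ℕ.* c
sumℕ-const zero    c = ≡.refl
sumℕ-const (suc n) c = cong (c ℕ.+_) (sumℕ-const n c)

sumℕ-scale : ∀ {n} c (f : Fin n → ℕ) → sumℕ (λ i → c ℕ.* f i) ≡ c ℕ.* sumℕ f
sumℕ-scale {zero}  c f = ≡.sym (ℕP.*-zeroʳ c)
sumℕ-scale {suc n} c f = ≡.trans (cong (c ℕ.* f zero ℕ.+_) (sumℕ-scale c (f ∘ suc)))
  (≡.sym (ℕP.*-distribˡ-+ c (f zero) _))

sumℕ-++ : ∀ m {n} (f : Fin (m ℕ.+ n) → ℕ) →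
  sumℕ f ≡ sumℕ (λ i → f (i ↑ˡ n)) ℕ.+ sumℕ (λ i → f (m ↑ʳ i))
sumℕ-++ zero    f = ≡.refl
sumℕ-++ (suc m) f = ≡.trans (cong (f zero ℕ.+_) (sumℕ-++ m (f ∘ suc))) (≡.sym (ℕP.+-assoc (f zero) _ _))

-- Positions are t-digit numbers in base b, and this prepends a leading digit. Base 3 indexes code
-- coordinates, base 2 information bits.
part : ∀ {b} t → Fin b → Fin (b ℕ.^ t) → Fin (b ℕ.^ suc t)
part t = combine

-- The t-th tensor power of the parity code of length 3.
IsCodeword : ∀ t → (Fin (3 ℕ.^ t) → Bool) → Set
IsCodeword zero    f = ⊤
IsCodeword (suc t) f = IsCodeword t (f ∘ part t 0F) × IsCodeword t (f ∘ part t 1F) ×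
  (∀ p → f (part t 2F p) ≡ f (part t 0F p) xor f (part t 1F p))

IsCodeword-cong : ∀ t {f g} → f ≗ g → IsCodeword t f → IsCodeword t g
IsCodeword-cong zero    e _ = tt
IsCodeword-cong (suc t) e (c₀ , c₁ , x) =
  IsCodeword-cong t (e ∘ part t 0F) c₀ , IsCodeword-cong t (e ∘ part t 1F) c₁ ,
  λ p → ≡.trans (≡.sym (e (part t 2F p)))
    (≡.trans (x p) (cong₂ _xor_ (e (part t 0F p)) (e (part t 1F p))))

𝟙 : Bool → ℕ
𝟙 b = if b then 1 else 0

𝟙≤1 : ∀ b → 𝟙 b ℕ.≤ 1
𝟙≤1 true  = ℕP.≤-refl
𝟙≤1 false = ℕ.z≤n

hamming : ∀ {n} → (f g : Fin n → Bool) → ℕ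
hamming f g = sumℕ (λ i → 𝟙 (f i xor g i))

sumℕ-parts : ∀ t (f : Fin (3 ℕ.^ suc t) → ℕ) → sumℕ f ≡
  sumℕ (f ∘ part t 0F) ℕ.+ (sumℕ (f ∘ part t 1F) ℕ.+ sumℕ (f ∘ part t 2F))
sumℕ-parts t f = ≡.trans (sumℕ-++ (3 ℕ.^ t) f) (cong (sumℕ (f ∘ part t 0F) ℕ.+_)
  (≡.trans (sumℕ-++ (3 ℕ.^ t) _) (cong (sumℕ (f ∘ part t 1F) ℕ.+_)
    (≡.trans (sumℕ-++ (3 ℕ.^ t) _) (ℕP.+-identityʳ _)))))

hamming-sym : ∀ {n} (f g : Fin n → Bool) → hamming f g ≡ hamming g f
hamming-sym f g = sumℕ-cong (λ i → cong 𝟙 (xor-comm (f i) (g i)))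

hammingᵖ : ∀ t (f g : Fin (3 ℕ.^ suc t) → Bool) → Fin 3 → ℕ
hammingᵖ t f g i = hamming (f ∘ part t i) (g ∘ part t i)

-- Two triples of even parity differ in an even number of places, so a difference in one place
-- forces another.
triangle : ∀ a b c a′ b′ c′ → c ≡ a xor b → c′ ≡ a′ xor b′ →
  𝟙 (a xor a′) ℕ.≤ 𝟙 (b xor b′) ℕ.+ 𝟙 (c xor c′) ×
  𝟙 (b xor b′) ℕ.≤ 𝟙 (a xor a′) ℕ.+ 𝟙 (c xor c′)
triangle false false _ false false _ ≡.refl ≡.refl = ℕ.z≤n , ℕ.z≤n
triangle false false _ false true  _ ≡.refl ≡.refl = ℕ.z≤n , ℕP.≤-refl
triangle false false _ true  false _ ≡.refl ≡.refl = ℕP.≤-refl , ℕ.z≤n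
triangle false false _ true  true  _ ≡.refl ≡.refl = ℕP.≤-refl , ℕP.≤-refl
triangle false true  _ false false _ ≡.refl ≡.refl = ℕ.z≤n , ℕP.≤-refl
triangle false true  _ false true  _ ≡.refl ≡.refl = ℕ.z≤n , ℕ.z≤n
triangle false true  _ true  false _ ≡.refl ≡.refl = ℕP.≤-refl , ℕP.≤-refl
triangle false true  _ true  true  _ ≡.refl ≡.refl = ℕP.≤-refl , ℕ.z≤n
triangle true  false _ false false _ ≡.refl ≡.refl = ℕP.≤-refl , ℕ.z≤n
triangle true  false _ false true  _ ≡.refl ≡.refl = ℕP.≤-refl , ℕP.≤-refl
triangle true  false _ true  false _ ≡.refl ≡.refl = ℕ.z≤n , ℕ.z≤n
triangle true  false _ true  true  _ ≡.refl ≡.refl = ℕ.z≤n , ℕP.≤-refl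
triangle true  true  _ false false _ ≡.refl ≡.refl = ℕP.≤-refl , ℕP.≤-refl
triangle true  true  _ false true  _ ≡.refl ≡.refl = ℕP.≤-refl , ℕ.z≤n
triangle true  true  _ true  false _ ≡.refl ≡.refl = ℕ.z≤n , ℕP.≤-refl
triangle true  true  _ true  true  _ ≡.refl ≡.refl = ℕ.z≤n , ℕ.z≤n

hammingᵖ-triangle : ∀ t {f g} → IsCodeword (suc t) f → IsCodeword (suc t) g →
  let h = hammingᵖ t f g in h 0F ℕ.≤ h 1F ℕ.+ h 2F × h 1F ℕ.≤ h 0F ℕ.+ h 2F
hammingᵖ-triangle t {f} {g} (_ , _ , f₂) (_ , _ , g₂) =
  ℕP.≤-trans (sumℕ-mono (proj₁ ∘ parity)) (ℕP.≤-reflexive (sumℕ-distrib-+ (differ 1F) (differ 2F))) ,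
  ℕP.≤-trans (sumℕ-mono (proj₂ ∘ parity)) (ℕP.≤-reflexive (sumℕ-distrib-+ (differ 0F) (differ 2F)))
  where
  differ : Fin 3 → Fin (3 ℕ.^ t) → ℕ
  differ i p = 𝟙 (f (part t i p) xor g (part t i p))

  parity : ∀ p → differ 0F p ℕ.≤ differ 1F p ℕ.+ differ 2F p ×
                 differ 1F p ℕ.≤ differ 0F p ℕ.+ differ 2F p
  parity p = triangle (f (part t 0F p)) (f (part t 1F p)) _ (g (part t 0F p)) (g (part t 1F p)) _
    (f₂ p) (g₂ p)

-- If one of the first two blocks differs, induction gives distance 2^t there, and the parity
-- triangle gives at least as much in the other two blocks together. The distance doubles with each
-- level.
codeword-distance : ∀ t {f g} → IsCodeword t f → IsCodeword t g → f ≗ g ⊎ 2 ℕ.^ t ℕ.≤ hamming f g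
codeword-distance zero {f} {g} _ _ with f 0F ≟ᵇ g 0F
... | yes e = inj₁ λ { 0F → e }
... | no ¬e = inj₂ (differ (f 0F) (g 0F) ¬e)
  where
  differ : ∀ a b → ¬ a ≡ b → 1 ℕ.≤ 𝟙 (a xor b) ℕ.+ 0
  differ false false ¬e = contradiction ≡.refl ¬e
  differ false true  _  = ℕP.≤-refl
  differ true  false _  = ℕP.≤-refl
  differ true  true  ¬e = contradiction ≡.refl ¬e
codeword-distance (suc t) {f} {g} cf@(f₀ , f₁ , f₂) cg@(g₀ , g₁ , g₂)
  with codeword-distance t f₀ g₀ | codeword-distance t f₁ g₁
... | inj₁ e₀ | inj₁ e₁ = inj₁ equal
  where
  equalᵖ : ∀ i p → f (part t i p) ≡ g (part t i p)
  equalᵖ 0F = e₀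
  equalᵖ 1F = e₁
  equalᵖ 2F p = ≡.trans (f₂ p) (≡.trans (cong₂ _xor_ (e₀ p) (e₁ p)) (≡.sym (g₂ p)))

  equal : f ≗ g
  equal p = subst (λ q → f q ≡ g q) (combine-remQuot {3} (3 ℕ.^ t) p)
    (equalᵖ (proj₁ (remQuot {3} (3 ℕ.^ t) p)) (proj₂ (remQuot {3} (3 ℕ.^ t) p)))
... | inj₂ h₀ | _ = inj₂ (begin
  2 ℕ.* 2 ℕ.^ t                 ≡⟨ cong (2 ℕ.^ t ℕ.+_) (ℕP.+-identityʳ _) ⟩
  2 ℕ.^ t ℕ.+ 2 ℕ.^ t           ≤⟨ ℕP.+-mono-≤ h₀ (ℕP.≤-trans h₀ (proj₁ (hammingᵖ-triangle t {f} {g} cf cg))) ⟩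
  h 0F ℕ.+ (h 1F ℕ.+ h 2F)      ≡⟨ sumℕ-parts t _ ⟨
  hamming f g                   ∎)
  where
  open ℕP.≤-Reasoning
  h = hammingᵖ t f g
... | inj₁ _ | inj₂ h₁ = inj₂ (begin
  2 ℕ.* 2 ℕ.^ t                 ≡⟨ cong (2 ℕ.^ t ℕ.+_) (ℕP.+-identityʳ _) ⟩
  2 ℕ.^ t ℕ.+ 2 ℕ.^ t           ≤⟨ ℕP.+-mono-≤ h₁ (ℕP.≤-trans h₁ (proj₂ (hammingᵖ-triangle t {f} {g} cf cg))) ⟩
  h 1F ℕ.+ (h 0F ℕ.+ h 2F)      ≡⟨ Algebra.Properties.CommutativeSemigroup.x∙yz≈y∙xz ℕP.+-commutativeSemigroup (h 1F) (h 0F) (h 2F) ⟩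
  h 0F ℕ.+ (h 1F ℕ.+ h 2F)      ≡⟨ sumℕ-parts t _ ⟨
  hamming f g                   ∎)
  where
  open ℕP.≤-Reasoning
  h = hammingᵖ t f g

encode : ∀ t → (Fin (2 ℕ.^ t) → Bool) → Fin (3 ℕ.^ t) → Bool
encodeᵖ : ∀ t → (Fin (2 ℕ.^ suc t) → Bool) → Fin 3 → Fin (3 ℕ.^ t) → Bool
encode zero    x _ = x 0F
encode (suc t) x p = encodeᵖ t x (proj₁ (remQuot {3} (3 ℕ.^ t) p)) (proj₂ (remQuot {3} (3 ℕ.^ t) p))
encodeᵖ t x 0F p = encode t (x ∘ part t 0F) p
encodeᵖ t x 1F p = encode t (x ∘ part t 1F) p
encodeᵖ t x 2F p = encode t (x ∘ part t 0F) p xor encode t (x ∘ part t 1F) p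

encode-part : ∀ t x i p → encode (suc t) x (part t i p) ≡ encodeᵖ t x i p
encode-part t x i p = cong (λ (j , q) → encodeᵖ t x j q) (remQuot-combine {3} {3 ℕ.^ t} i p)

encode-isCodeword : ∀ t x → IsCodeword t (encode t x)
encode-isCodeword zero    x = tt
encode-isCodeword (suc t) x =
  IsCodeword-cong t (λ p → ≡.sym (encode-part t x 0F p)) (encode-isCodeword t (x ∘ part t 0F)) ,
  IsCodeword-cong t (λ p → ≡.sym (encode-part t x 1F p)) (encode-isCodeword t (x ∘ part t 1F)) ,
  λ p → ≡.trans (encode-part t x 2F p)
    (≡.sym (cong₂ _xor_ (encode-part t x 0F p) (encode-part t x 1F p)))

-- The binary digits of j are reread as ternary digits: the code is systematic on the positions
-- without a digit 2.
info : ∀ t → Fin (2 ℕ.^ t) → Fin (3 ℕ.^ t)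
info zero    _ = 0F
info (suc t) j = part t (inject₁ (proj₁ (remQuot {2} (2 ℕ.^ t) j))) (info t (proj₂ (remQuot {2} (2 ℕ.^ t) j)))

encode-info : ∀ t x j → encode t x (info t j) ≡ x j
encode-info zero    x 0F = ≡.refl
encode-info (suc t) x j =
  let b , i = remQuot {2} (2 ℕ.^ t) j in
  ≡.trans (encode-part t x (inject₁ b) (info t i)) (≡.trans (bit b i)
    (cong x (combine-remQuot {2} (2 ℕ.^ t) j)))
  where
  bit : ∀ b i → encodeᵖ t x (inject₁ b) (info t i) ≡ x (part t b i)
  bit 0F i = encode-info t (x ∘ part t 0F) i
  bit 1F i = encode-info t (x ∘ part t 1F) i

-- Parity and negation as 3CNF constraints

forbidding : ∀ {n} → Fin n → Fin n → Fin n → Bool → Bool → Bool → Clause n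
forbidding x y z a b c = (x , not a) ∷ (y , not b) ∷ (z , not c) ∷ []

module _ {n} (σ : Subset n) {x y z : Fin n} {a b c : Bool} where

  forbid : Any (λ (x , b) → lookup σ x ≡ b) (forbidding x y z a b c) →
    ¬ (lookup σ x ≡ a × lookup σ y ≡ b × lookup σ z ≡ c)
  forbid (here e)                 (p , _ , _) = not-¬ p e
  forbid (there (here e))         (_ , p , _) = not-¬ p e
  forbid (there (there (here e))) (_ , _ , p) = not-¬ p e

  allow : ¬ (lookup σ x ≡ a × lookup σ y ≡ b × lookup σ z ≡ c) →
    Any (λ (x , b) → lookup σ x ≡ b) (forbidding x y z a b c)
  allow h with lookup σ x ≟ᵇ a | lookup σ y ≟ᵇ b | lookup σ z ≟ᵇ c
  ... | no ¬p | _     | _     = here (¬-not ¬p)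
  ... | yes _ | no ¬p | _     = there (here (¬-not ¬p))
  ... | yes _ | yes _ | no ¬p = there (there (here (¬-not ¬p)))
  ... | yes p | yes q | yes r = contradiction (p , q , r) h

-- The excluded patterns are the four triples of odd parity.
xorConstraint : ∀ {n} → Fin n → Fin n → Fin n → Formula n
xorConstraint x y z =
  forbidding x y z false false true ∷ forbidding x y z false true false ∷
  forbidding x y z true false false ∷ forbidding x y z true true true ∷ []

xorConstraint⁻ : ∀ {n} (σ : Subset n) x y z → Satisfies σ (xorConstraint x y z) →
  lookup σ z ≡ lookup σ x xor lookup σ y
xorConstraint⁻ σ x y z (c₁ ∷ c₂ ∷ c₃ ∷ c₄ ∷ [])
  with lookup σ x in p | lookup σ y in q | lookup σ z in r
... | false | false | false = ≡.refl
... | false | false | true  = contradiction (p , q , r) (forbid σ c₁)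
... | false | true  | false = contradiction (p , q , r) (forbid σ c₂)
... | false | true  | true  = ≡.refl
... | true  | false | false = contradiction (p , q , r) (forbid σ c₃)
... | true  | false | true  = ≡.refl
... | true  | true  | false = ≡.refl
... | true  | true  | true  = contradiction (p , q , r) (forbid σ c₄)

xorConstraint⁺ : ∀ {n} (σ : Subset n) x y z → lookup σ z ≡ lookup σ x xor lookup σ y →
  Satisfies σ (xorConstraint x y z)
xorConstraint⁺ σ x y z h = allow σ (violates ≡.refl) ∷ allow σ (violates ≡.refl) ∷ allow σ (violates ≡.refl) ∷ allow σ (violates ≡.refl) ∷ []
  where
  violates : ∀ {a b c} → c ≡ not (a xor b) →
    ¬ (lookup σ x ≡ a × lookup σ y ≡ b × lookup σ z ≡ c)
  violates e (p , q , r) = not-¬ (cong₂ _xor_ p q) (≡.trans (≡.sym h) (≡.trans r e))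

-- The second variable is repeated to fill clauses of three literals.
notConstraint : ∀ {n} → Fin n → Fin n → Formula n
notConstraint x y = forbidding x y y false false false ∷ forbidding x y y true true true ∷ []

notConstraint⁻ : ∀ {n} (σ : Subset n) x y → Satisfies σ (notConstraint x y) →
  lookup σ y ≡ not (lookup σ x)
notConstraint⁻ σ x y (c₁ ∷ c₂ ∷ []) with lookup σ x in p | lookup σ y in q
... | false | false = contradiction (p , q , q) (forbid σ c₁)
... | false | true  = ≡.refl
... | true  | false = ≡.refl
... | true  | true  = contradiction (p , q , q) (forbid σ c₂)

notConstraint⁺ : ∀ {n} (σ : Subset n) x y → lookup σ y ≡ not (lookup σ x) →
  Satisfies σ (notConstraint x y)
notConstraint⁺ σ x y h = allow σ violates ∷ allow σ violates ∷ []
  where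
  violates : ∀ {a} → ¬ (lookup σ x ≡ a × lookup σ y ≡ a × lookup σ y ≡ a)
  violates (p , q , _) = not-¬ (≡.trans p (≡.sym q)) (≡.trans (≡.sym (not-involutive _)) (cong not (≡.sym h)))

each : ∀ {m n} → (Fin m → Formula n) → Formula n
each Φ = concat (tabulate Φ)

each⁺ : ∀ {m n} (σ : Subset n) (Φ : Fin m → Formula n) → (∀ i → Satisfies σ (Φ i)) → Satisfies σ (each Φ)
each⁺ σ Φ h = concat⁺ (tabulate⁺ h)

each⁻ : ∀ {m n} (σ : Subset n) (Φ : Fin m → Formula n) → Satisfies σ (each Φ) → ∀ i → Satisfies σ (Φ i)
each⁻ σ Φ h = tabulate⁻ (concat⁻ h)

codeFormula : ∀ {n} t → (Fin (3 ℕ.^ t) → Fin n) → Formula n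
codeFormula zero    u = []
codeFormula (suc t) u = codeFormula t (u ∘ part t 0F) ++ codeFormula t (u ∘ part t 1F) ++
  each (λ p → xorConstraint (u (part t 0F p)) (u (part t 1F p)) (u (part t 2F p)))

codeFormula⁺ : ∀ {n} (σ : Subset n) t u → IsCodeword t (lookup σ ∘ u) → Satisfies σ (codeFormula t u)
codeFormula⁺ σ zero    u _ = []
codeFormula⁺ σ (suc t) u (c₀ , c₁ , x) = ++⁺ (codeFormula⁺ σ t _ c₀) (++⁺ (codeFormula⁺ σ t _ c₁)
  (each⁺ σ _ (λ p → xorConstraint⁺ σ _ _ _ (x p))))

codeFormula⁻ : ∀ {n} (σ : Subset n) t u → Satisfies σ (codeFormula t u) → IsCodeword t (lookup σ ∘ u)
codeFormula⁻ σ zero    u _ = tt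
codeFormula⁻ σ (suc t) u h =
  codeFormula⁻ σ t _ (++⁻ˡ Φ₀ h) , codeFormula⁻ σ t _ (++⁻ˡ Φ₁ (++⁻ʳ Φ₀ h)) ,
  λ p → xorConstraint⁻ σ _ _ _ (each⁻ σ
    (λ p → xorConstraint (u (part t 0F p)) (u (part t 1F p)) (u (part t 2F p))) (++⁻ʳ Φ₁ (++⁻ʳ Φ₀ h)) p)
  where
  Φ₀ = codeFormula t (u ∘ part t 0F)
  Φ₁ = codeFormula t (u ∘ part t 1F)

sumℕ-single : ∀ {n} (f : Fin n → ℕ) j → (∀ i → ¬ i ≡ j → f i ≡ 0) → sumℕ f ≡ f j
sumℕ-single {suc n} f zero    h = ≡.trans (cong (f zero ℕ.+_)
  (≡.trans (sumℕ-cong (λ i → h (suc i) λ ())) (≡.trans (sumℕ-const n 0) (ℕP.*-zeroʳ n)))) (ℕP.+-identityʳ (f zero))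
sumℕ-single {suc n} f (suc j) h = cong₂ ℕ._+_ (h zero λ ())
  (sumℕ-single (f ∘ suc) j (λ i i≢j → h (suc i) (i≢j ∘ suc-injective)))

lookup-─ : ∀ {n} (A A′ : Subset n) i → lookup (A ─ A′) i ≡ lookup A i ∧ not (lookup A′ i)
lookup-─ (a ∷ _)     (true ∷ _)  zero    = ≡.sym (∧-zeroʳ a)
lookup-─ (a ∷ _)     (false ∷ _) zero    = ≡.sym (∧-identityʳ a)
lookup-─ (_ ∷ A) (_ ∷ A′) (suc i) = lookup-─ A A′ i

sumℕ-zero : ∀ {n} {f : Fin n → ℕ} → (∀ i → f i ≡ 0) → sumℕ f ≡ 0
sumℕ-zero {n} h = ≡.trans (sumℕ-cong h) (≡.trans (sumℕ-const n 0) (ℕP.*-zeroʳ n))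

-- Together with `natDistance`, a copy of `totalWeight` and `d-w` over ℕ: the instances have natural
-- weights, so their combinatorics is done without reals.
natWeight : ∀ {n} → (Fin n → ℕ) → Subset n → ℕ
natWeight f A = sumℕ (λ i → if lookup A i then f i else 0)

natDistance : ∀ {n} → Subset n → (Fin n → ℕ) → Subset n → (Fin n → ℕ) → ℕ
natDistance A f A′ f′ =
  sumℕ (λ i → if lookup (A ∩ A′) i then ℕ.∣ f i - f′ i ∣ else 0)
  ℕ.+ sumℕ (λ i → if lookup (A ─ A′) i then f i else 0)
  ℕ.+ sumℕ (λ i → if lookup (A′ ─ A) i then f′ i else 0)

-- Solutions carry k bits; agreeing with a target bit pays B, and solutions that differ
-- have distance at least D.
record HardInstance (n k B D : ℕ) : Set where
  field
    Φ : Formula n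
    wt : Subset k → Fin n → ℕ
    agreement : Subset k → Fin k → Subset n → ℕ
    best : Subset k → Subset n
    best-satisfies : ∀ x → Satisfies (best x) Φ
    best-weight : ∀ x → natWeight (wt x) (best x) ≡ 2 ℕ.* (k ℕ.* B)
    weight-≤ : ∀ x A → Satisfies A Φ → natWeight (wt x) A ℕ.≤ 2 ℕ.* (k ℕ.* B)
    weight-agreement : ∀ x A → Satisfies A Φ →
      natWeight (wt x) A ℕ.≤ k ℕ.* B ℕ.+ B ℕ.* sumℕ (λ j → agreement x j A)
    separated : ∀ x j A A′ → Satisfies A Φ → Satisfies A′ Φ →
      D ℕ.* (agreement x j A ℕ.+ agreement (x [ j ]%= not) j A′) ℕ.≤
      D ℕ.+ natDistance A (wt x) A′ (wt (x [ j ]%= not))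
    wt-flip-sum : ∀ x j → sumℕ (λ i → ℕ.∣ wt x i - wt (x [ j ]%= not) i ∣) ≡ 2 ℕ.* B

-- The hard instance built from the code

module Gadget (t r : ℕ) where

  k B n : ℕ
  k = 2 ℕ.^ t
  B = 3 ℕ.^ t
  n = B ℕ.+ (B ℕ.+ (k ℕ.+ (k ℕ.+ r)))

  u ū : Fin B → Fin n
  u p = p ↑ˡ _
  ū p = B ↑ʳ (p ↑ˡ _)

  y ȳ : Fin k → Fin n
  y j = B ↑ʳ (B ↑ʳ (j ↑ˡ _))
  ȳ j = B ↑ʳ (B ↑ʳ (k ↑ʳ (j ↑ˡ r)))

  -- Unconstrained variables of weight zero, which bring the instance to any prescribed number of
  -- variables.
  padding : Fin r → Fin n
  padding i = B ↑ʳ (B ↑ʳ (k ↑ʳ (k ↑ʳ i)))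

  -- The copy `y j` equals its information bit as the complement of a complement, through `ȳ j`.
  -- Putting the bonuses on copies leaves the weights of `u` and `ū` independent of the target.
  Φ : Formula n
  Φ = codeFormula t u ++ each (λ p → notConstraint (u p) (ū p)) ++
    each (λ j → notConstraint (u (info t j)) (ȳ j)) ++ each (λ j → notConstraint (y j) (ȳ j))

  record Layout (A : Subset n) : Set where
    field
      codeword : IsCodeword t (lookup A ∘ u)
      u-ū : ∀ p → lookup A (ū p) ≡ not (lookup A (u p))
      u-ȳ : ∀ j → lookup A (ȳ j) ≡ not (lookup A (u (info t j)))
      y-ȳ : ∀ j → lookup A (ȳ j) ≡ not (lookup A (y j))

    u-y : ∀ j → lookup A (y j) ≡ lookup A (u (info t j))
    u-y j = not-injective (≡.trans (≡.sym (y-ȳ j)) (u-ȳ j))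

  open Layout

  Φ⁺ : ∀ {A} → Layout A → Satisfies A Φ
  Φ⁺ {A} l = ++⁺ (codeFormula⁺ A t u (codeword l))
    (++⁺ (each⁺ A _ (λ p → notConstraint⁺ A _ _ (u-ū l p)))
    (++⁺ (each⁺ A _ (λ j → notConstraint⁺ A _ _ (u-ȳ l j)))
         (each⁺ A _ (λ j → notConstraint⁺ A _ _ (y-ȳ l j)))))

  Φ⁻ : ∀ {A} → Satisfies A Φ → Layout A
  Φ⁻ {A} h = record
    { codeword = codeFormula⁻ A t u (++⁻ˡ Φ₀ h)
    ; u-ū = λ p → notConstraint⁻ A _ _ (each⁻ A Ψ₁ (++⁻ˡ (each Ψ₁) (++⁻ʳ Φ₀ h)) p)
    ; u-ȳ = λ j → notConstraint⁻ A _ _ (each⁻ A Ψ₂ (++⁻ˡ (each Ψ₂) (++⁻ʳ (each Ψ₁) (++⁻ʳ Φ₀ h))) j)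
    ; y-ȳ = λ j → notConstraint⁻ A _ _ (each⁻ A Ψ₃ (++⁻ʳ (each Ψ₂) (++⁻ʳ (each Ψ₁) (++⁻ʳ Φ₀ h))) j)
    }
    where
    Φ₀ = codeFormula t u
    Ψ₁ = λ p → notConstraint (u p) (ū p)
    Ψ₂ = λ j → notConstraint (u (info t j)) (ȳ j)
    Ψ₃ = λ j → notConstraint (y j) (ȳ j)

  -- Serves both for weights, with values in ℕ, and for the optimal assignment, with values in
  -- `Bool`.
  module Blocks {X : Set} (f g : Fin B → X) (h h̄ : Fin k → X) (e : Fin r → X) where

    blocks : Fin n → X
    blocks = f Vector.++ g Vector.++ h Vector.++ h̄ Vector.++ e

    at-u : ∀ p → blocks (u p) ≡ f p
    at-u p = ++-↑ˡ f (g Vector.++ h Vector.++ h̄ Vector.++ e) p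

    at-ū : ∀ p → blocks (ū p) ≡ g p
    at-ū p = ≡.trans (++-↑ʳ f (g Vector.++ h Vector.++ h̄ Vector.++ e) _)
      (++-↑ˡ g (h Vector.++ h̄ Vector.++ e) p)

    at-y : ∀ j → blocks (y j) ≡ h j
    at-y j = ≡.trans (++-↑ʳ f (g Vector.++ h Vector.++ h̄ Vector.++ e) _)
      (≡.trans (++-↑ʳ g (h Vector.++ h̄ Vector.++ e) _) (++-↑ˡ h (h̄ Vector.++ e) j))

    at-ȳ : ∀ j → blocks (ȳ j) ≡ h̄ j
    at-ȳ j = ≡.trans (++-↑ʳ f (g Vector.++ h Vector.++ h̄ Vector.++ e) _)
      (≡.trans (++-↑ʳ g (h Vector.++ h̄ Vector.++ e) _)
      (≡.trans (++-↑ʳ h (h̄ Vector.++ e) _) (++-↑ˡ h̄ e j)))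

    at-padding : ∀ i → blocks (padding i) ≡ e i
    at-padding i = ≡.trans (++-↑ʳ f (g Vector.++ h Vector.++ h̄ Vector.++ e) _)
      (≡.trans (++-↑ʳ g (h Vector.++ h̄ Vector.++ e) _)
      (≡.trans (++-↑ʳ h (h̄ Vector.++ e) _) (++-↑ʳ h̄ e i)))

  sumℕ-blocks : ∀ f → sumℕ f ≡ (sumℕ (f ∘ u) ℕ.+ sumℕ (f ∘ ū)) ℕ.+
    ((sumℕ (f ∘ y) ℕ.+ sumℕ (f ∘ ȳ)) ℕ.+ sumℕ (f ∘ padding))
  sumℕ-blocks f = begin
    sumℕ f
      ≡⟨ sumℕ-++ B f ⟩
    U ℕ.+ sumℕ (λ i → f (B ↑ʳ i))
      ≡⟨ cong (U ℕ.+_) (sumℕ-++ B _) ⟩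
    U ℕ.+ (Ū ℕ.+ sumℕ (λ i → f (B ↑ʳ (B ↑ʳ i))))
      ≡⟨ cong (λ s → U ℕ.+ (Ū ℕ.+ s)) (sumℕ-++ k _) ⟩
    U ℕ.+ (Ū ℕ.+ (Y ℕ.+ sumℕ (λ i → f (B ↑ʳ (B ↑ʳ (k ↑ʳ i))))))
      ≡⟨ cong (λ s → U ℕ.+ (Ū ℕ.+ (Y ℕ.+ s))) (sumℕ-++ k _) ⟩
    U ℕ.+ (Ū ℕ.+ (Y ℕ.+ (Ȳ ℕ.+ P)))
      ≡⟨ ℕP.+-assoc U Ū _ ⟨
    U ℕ.+ Ū ℕ.+ (Y ℕ.+ (Ȳ ℕ.+ P))
      ≡⟨ cong (U ℕ.+ Ū ℕ.+_) (ℕP.+-assoc Y Ȳ P) ⟨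
    U ℕ.+ Ū ℕ.+ (Y ℕ.+ Ȳ ℕ.+ P) ∎
    where
    open ≡.≡-Reasoning
    U Ū Y Ȳ P : ℕ
    U = sumℕ (f ∘ u)
    Ū = sumℕ (f ∘ ū)
    Y = sumℕ (f ∘ y)
    Ȳ = sumℕ (f ∘ ȳ)
    P = sumℕ (f ∘ padding)

  module _ (x : Subset k) where
    private
      module W = Blocks (λ _ → k) (λ _ → k)
        (λ j → if lookup x j then B else 0) (λ j → if lookup x j then 0 else B) (λ _ → 0)
      module E = Blocks (encode t (lookup x)) (not ∘ encode t (lookup x))
        (lookup x) (not ∘ lookup x) (λ _ → false)

    wt : Fin n → ℕ
    wt = W.blocks

    open W public using () renaming (at-u to wt-u; at-ū to wt-ū; at-y to wt-y; at-ȳ to wt-ȳ; at-padding to wt-padding)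

    total : Subset n → ℕ
    total A = natWeight wt A

    agreement : Fin k → Subset n → ℕ
    agreement j A = 𝟙 (not (lookup x j xor lookup A (y j)))

    best : Subset n
    best = Vec.tabulate E.blocks

    lookup-best : ∀ {i b} → E.blocks i ≡ b → lookup best i ≡ b
    lookup-best {i} = ≡.trans (lookup∘tabulate E.blocks i)

    best-layout : Layout best
    best-layout = record
      { codeword = IsCodeword-cong t (λ p → ≡.sym (lookup-best (E.at-u p))) (encode-isCodeword t (lookup x))
      ; u-ū = λ p → ≡.trans (lookup-best (E.at-ū p)) (cong not (≡.sym (lookup-best (E.at-u p))))
      ; u-ȳ = λ j → ≡.trans (lookup-best (E.at-ȳ j)) (cong not (≡.sym
          (≡.trans (lookup-best (E.at-u (info t j))) (encode-info t (lookup x) j))))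
      ; y-ȳ = λ j → ≡.trans (lookup-best (E.at-ȳ j)) (cong not (≡.sym (lookup-best (E.at-y j))))
      }

    best-agreement : ∀ j → agreement j best ≡ 1
    best-agreement j = ≡.trans (cong (λ b → 𝟙 (not (lookup x j xor b))) (lookup-best (E.at-y j)))
      (cong (𝟙 ∘ not) (xor-same (lookup x j)))

  kB+Bk : k ℕ.* B ℕ.+ B ℕ.* k ≡ 2 ℕ.* (k ℕ.* B)
  kB+Bk = cong (k ℕ.* B ℕ.+_) (≡.trans (ℕP.*-comm B k) (≡.sym (ℕP.+-identityʳ (k ℕ.* B))))

  module _ (x : Subset k) {A : Subset n} (l : Layout A) where

    -- Exactly one of `u p`, `ū p` is chosen, which contributes k whatever the codeword; exactly one
    -- of `y j`, `ȳ j` is chosen, and it carries the bonus B precisely when bit j matches the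
    -- target.
    total-layout : total x A ≡ k ℕ.* B ℕ.+ B ℕ.* sumℕ (λ j → agreement x j A)
    total-layout = begin
      total x A
        ≡⟨ sumℕ-blocks g ⟩
      (sumℕ (g ∘ u) ℕ.+ sumℕ (g ∘ ū)) ℕ.+ ((sumℕ (g ∘ y) ℕ.+ sumℕ (g ∘ ȳ)) ℕ.+ sumℕ (g ∘ padding))
        ≡⟨ cong₂ (λ a b → a ℕ.+ (b ℕ.+ sumℕ (g ∘ padding)))
             (sumℕ-distrib-+ (g ∘ u) (g ∘ ū)) (sumℕ-distrib-+ (g ∘ y) (g ∘ ȳ)) ⟨
      sumℕ (λ p → g (u p) ℕ.+ g (ū p)) ℕ.+ (sumℕ (λ j → g (y j) ℕ.+ g (ȳ j)) ℕ.+ sumℕ (g ∘ padding))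
        ≡⟨ cong₂ ℕ._+_ (≡.trans (sumℕ-cong base) (≡.trans (sumℕ-const B k) (ℕP.*-comm B k)))
             (cong₂ ℕ._+_ (≡.trans (sumℕ-cong bonus) (sumℕ-scale B (λ j → agreement x j A)))
               (≡.trans (sumℕ-cong none) (≡.trans (sumℕ-const r 0) (ℕP.*-zeroʳ r)))) ⟩
      k ℕ.* B ℕ.+ (B ℕ.* sumℕ (λ j → agreement x j A) ℕ.+ 0)
        ≡⟨ cong (k ℕ.* B ℕ.+_) (ℕP.+-identityʳ _) ⟩
      k ℕ.* B ℕ.+ B ℕ.* sumℕ (λ j → agreement x j A) ∎
      where
      open ≡.≡-Reasoning
      g : Fin n → ℕ
      g i = if lookup A i then wt x i else 0

      base : ∀ p → g (u p) ℕ.+ g (ū p) ≡ k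
      base p rewrite wt-u x p | wt-ū x p | u-ū l p with lookup A (u p)
      ... | true  = ℕP.+-identityʳ k
      ... | false = ≡.refl

      bonus : ∀ j → g (y j) ℕ.+ g (ȳ j) ≡ B ℕ.* agreement x j A
      bonus j rewrite wt-y x j | wt-ȳ x j | y-ȳ l j with lookup A (y j) | lookup x j
      ... | true  | true  = ≡.trans (ℕP.+-identityʳ B) (≡.sym (ℕP.*-identityʳ B))
      ... | true  | false = ≡.sym (ℕP.*-zeroʳ B)
      ... | false | true  = ≡.sym (ℕP.*-zeroʳ B)
      ... | false | false = ≡.sym (ℕP.*-identityʳ B)

      none : ∀ i → g (padding i) ≡ 0
      none i rewrite wt-padding x i with lookup A (padding i)
      ... | true  = ≡.refl
      ... | false = ≡.refl

    agreements≤k : sumℕ (λ j → agreement x j A) ℕ.≤ k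
    agreements≤k = ℕP.≤-trans (sumℕ-mono (λ j → 𝟙≤1 (not (lookup x j xor lookup A (y j)))))
      (ℕP.≤-reflexive (≡.trans (sumℕ-const k 1) (ℕP.*-identityʳ k)))

    total≤ : total x A ℕ.≤ 2 ℕ.* (k ℕ.* B)
    total≤ = begin
      total x A                                        ≡⟨ total-layout ⟩
      k ℕ.* B ℕ.+ B ℕ.* sumℕ (λ j → agreement x j A)   ≤⟨ ℕP.+-monoʳ-≤ (k ℕ.* B) (ℕP.*-monoʳ-≤ B agreements≤k) ⟩
      k ℕ.* B ℕ.+ B ℕ.* k                              ≡⟨ kB+Bk ⟩
      2 ℕ.* (k ℕ.* B)                                  ∎
      where open ℕP.≤-Reasoning

  total-best : ∀ x → total x (best x) ≡ 2 ℕ.* (k ℕ.* B)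
  total-best x = ≡.trans (total-layout x (best-layout x)) (≡.trans
    (cong (λ s → k ℕ.* B ℕ.+ B ℕ.* s) (≡.trans (sumℕ-cong (best-agreement x))
      (≡.trans (sumℕ-const k 1) (ℕP.*-identityʳ k)))) kB+Bk)

  flip : Subset k → Fin k → Subset k
  flip x j = x [ j ]%= not

  -- Wherever the codewords differ, exactly one of `u p`, `ū p` lies in `A ─ A′`. The complements
  -- thus make each one-sided difference see the full Hamming distance.
  difference≥ : ∀ x {A A′} → Layout A → Layout A′ →
    k ℕ.* hamming (lookup A ∘ u) (lookup A′ ∘ u) ℕ.≤ sumℕ (λ i → if lookup (A ─ A′) i then wt x i else 0)
  difference≥ x {A} {A′} l l′ = begin
    k ℕ.* hamming (lookup A ∘ u) (lookup A′ ∘ u)    ≡⟨ sumℕ-scale k (λ p → 𝟙 (lookup A (u p) xor lookup A′ (u p))) ⟨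
    sumℕ (λ p → k ℕ.* 𝟙 (lookup A (u p) xor lookup A′ (u p)))  ≡⟨ sumℕ-cong both ⟨
    sumℕ (λ p → g (u p) ℕ.+ g (ū p))                ≡⟨ sumℕ-distrib-+ (g ∘ u) (g ∘ ū) ⟩
    sumℕ (g ∘ u) ℕ.+ sumℕ (g ∘ ū)                   ≤⟨ ℕP.m≤m+n _ _ ⟩
    _                                               ≡⟨ sumℕ-blocks g ⟨
    sumℕ g                                          ∎
    where
    open ℕP.≤-Reasoning
    g : Fin n → ℕ
    g i = if lookup (A ─ A′) i then wt x i else 0

    both : ∀ p → g (u p) ℕ.+ g (ū p) ≡ k ℕ.* 𝟙 (lookup A (u p) xor lookup A′ (u p))
    both p rewrite lookup-─ A A′ (u p) | lookup-─ A A′ (ū p) | wt-u x p | wt-ū x p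
                 | u-ū l p | u-ū l′ p with lookup A (u p) | lookup A′ (u p)
    ... | true  | true  = ≡.sym (ℕP.*-zeroʳ k)
    ... | true  | false = ≡.trans (ℕP.+-identityʳ k) (≡.sym (ℕP.*-identityʳ k))
    ... | false | true  = ≡.sym (ℕP.*-identityʳ k)
    ... | false | false = ≡.sym (ℕP.*-zeroʳ k)

  -- One factor `k` is the weight of a code variable, the other the minimum distance, which is also
  -- 2^t; the 2 counts the differences in both directions.
  D : ℕ
  D = 2 ℕ.* (k ℕ.* k)

  -- For equal codewords the shared bit j matches exactly one of two opposite targets, so the left
  -- side is D. For distinct codewords it is at most 2D, and the distance supplies the second D.
  separated : ∀ x j {A A′} → Layout A → Layout A′ →
    D ℕ.* (agreement x j A ℕ.+ agreement (flip x j) j A′) ℕ.≤ D ℕ.+ natDistance A (wt x) A′ (wt (flip x j))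
  separated x j {A} {A′} l l′ with codeword-distance t (codeword l) (codeword l′)
  ... | inj₁ e = begin
    D ℕ.* (agreement x j A ℕ.+ agreement (flip x j) j A′) ≡⟨ cong (D ℕ.*_) exclusive ⟩
    D ℕ.* 1                   ≡⟨ ℕP.*-identityʳ D ⟩
    D                         ≤⟨ ℕP.m≤m+n D _ ⟩
    D ℕ.+ natDistance A (wt x) A′ (wt (flip x j))   ∎
    where
    open ℕP.≤-Reasoning
    exclusive : agreement x j A ℕ.+ agreement (flip x j) j A′ ≡ 1
    exclusive rewrite lookup∘updateAt j {not} x | u-y l j | u-y l′ j | e (info t j)
      with lookup x j | lookup A′ (u (info t j))
    ... | true  | true  = ≡.refl
    ... | true  | false = ≡.refl
    ... | false | true  = ≡.refl
    ... | false | false = ≡.refl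
  ... | inj₂ h = begin
    D ℕ.* (agreement x j A ℕ.+ agreement (flip x j) j A′)
      ≤⟨ ℕP.*-monoʳ-≤ D (ℕP.+-mono-≤ (𝟙≤1 (not (lookup x j xor lookup A (y j))))
           (𝟙≤1 (not (lookup (flip x j) j xor lookup A′ (y j))))) ⟩
    D ℕ.* 2
      ≡⟨ ≡.trans (ℕP.*-comm D 2) (cong (D ℕ.+_) (ℕP.+-identityʳ D)) ⟩
    D ℕ.+ D
      ≤⟨ ℕP.+-monoʳ-≤ D (begin
        D                                    ≡⟨ cong (k ℕ.* k ℕ.+_) (ℕP.+-identityʳ _) ⟩
        k ℕ.* k ℕ.+ k ℕ.* k                  ≤⟨ ℕP.+-mono-≤ (ℕP.*-monoʳ-≤ k h) (ℕP.*-monoʳ-≤ k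
                                                  (ℕP.≤-trans h (ℕP.≤-reflexive (hamming-sym (lookup A ∘ u) (lookup A′ ∘ u))))) ⟩
        k ℕ.* hamming (lookup A ∘ u) (lookup A′ ∘ u) ℕ.+ k ℕ.* hamming (lookup A′ ∘ u) (lookup A ∘ u)
                                             ≤⟨ ℕP.+-mono-≤ (ℕP.≤-trans (difference≥ x l l′) (ℕP.m≤n+m _ _))
                                                  (difference≥ (flip x j) l′ l) ⟩
        natDistance A (wt x) A′ (wt (flip x j))                    ∎) ⟩
    D ℕ.+ natDistance A (wt x) A′ (wt (flip x j)) ∎
    where open ℕP.≤-Reasoning

  wt-flip-sum : ∀ x j → sumℕ (λ i → ℕ.∣ wt x i - wt (flip x j) i ∣) ≡ 2 ℕ.* B
  wt-flip-sum x j = begin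
    sumℕ g
      ≡⟨ sumℕ-blocks g ⟩
    (sumℕ (g ∘ u) ℕ.+ sumℕ (g ∘ ū)) ℕ.+ ((sumℕ (g ∘ y) ℕ.+ sumℕ (g ∘ ȳ)) ℕ.+ sumℕ (g ∘ padding))
      ≡⟨ cong₂ ℕ._+_ (cong₂ ℕ._+_ (sumℕ-zero g-u) (sumℕ-zero g-ū))
           (cong₂ ℕ._+_ (cong₂ ℕ._+_ (≡.trans (sumℕ-single (g ∘ y) j g-y≢) g-y) (≡.trans (sumℕ-single (g ∘ ȳ) j g-ȳ≢) g-ȳ)) (sumℕ-zero g-padding)) ⟩
    B ℕ.+ B ℕ.+ 0
      ≡⟨ ℕP.+-assoc B B 0 ⟩
    2 ℕ.* B ∎
    where
    open ≡.≡-Reasoning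
    g : Fin n → ℕ
    g i = ℕ.∣ wt x i - wt (flip x j) i ∣

    unchanged : ∀ {i a} → wt x i ≡ a → wt (flip x j) i ≡ a → g i ≡ 0
    unchanged {a = a} p q = ≡.trans (cong₂ ℕ.∣_-_∣ p q) (ℕP.∣n-n∣≡0 a)

    g-u : ∀ p → g (u p) ≡ 0
    g-u p = unchanged (wt-u x p) (wt-u (flip x j) p)

    g-ū : ∀ p → g (ū p) ≡ 0
    g-ū p = unchanged (wt-ū x p) (wt-ū (flip x j) p)

    g-padding : ∀ i → g (padding i) ≡ 0
    g-padding i = unchanged (wt-padding x i) (wt-padding (flip x j) i)

    g-y≢ : ∀ i → ¬ i ≡ j → g (y i) ≡ 0
    g-y≢ i i≢j = unchanged (wt-y x i) (≡.trans (wt-y (flip x j) i)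
      (cong (λ b → if b then B else 0) (lookup∘updateAt′ i j i≢j x)))

    g-ȳ≢ : ∀ i → ¬ i ≡ j → g (ȳ i) ≡ 0
    g-ȳ≢ i i≢j = unchanged (wt-ȳ x i) (≡.trans (wt-ȳ (flip x j) i)
      (cong (λ b → if b then 0 else B) (lookup∘updateAt′ i j i≢j x)))

    g-y : g (y j) ≡ B
    g-y rewrite wt-y x j | wt-y (flip x j) j | lookup∘updateAt j {not} x with lookup x j
    ... | true  = ℕP.∣-∣-identityʳ B
    ... | false = ≡.refl

    g-ȳ : g (ȳ j) ≡ B
    g-ȳ rewrite wt-ȳ x j | wt-ȳ (flip x j) j | lookup∘updateAt j {not} x with lookup x j
    ... | true  = ≡.refl
    ... | false = ℕP.∣-∣-identityʳ B

  hardInstance : HardInstance n k B D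
  hardInstance = record
    { Φ = Φ
    ; wt = wt
    ; agreement = agreement
    ; best = best
    ; best-satisfies = λ x → Φ⁺ (best-layout x)
    ; best-weight = total-best
    ; weight-≤ = λ x A h → total≤ x (Φ⁻ {A} h)
    ; weight-agreement = λ x A h → ℕP.≤-reflexive (total-layout x (Φ⁻ {A} h))
    ; separated = λ x j A A′ h h′ → separated x j (Φ⁻ {A} h) (Φ⁻ {A′} h′)
    ; wt-flip-sum = wt-flip-sum
    }

-- The lower bound

open HardInstance

totalWeight-value : ∀ {n} (w : Weights n) {f : Fin n → ℕ} → (∀ i → weight w i ≐ f i) →
  ∀ A → totalWeight w A ≐ natWeight f A
totalWeight-value w {f} w≐f A = ≐-∑∈ A {weight w} {f} w≐f

module _ {n} (w w′ : Weights n) {f f′ : Fin n → ℕ}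
  (w≐f : ∀ i → weight w i ≐ f i) (w′≐f′ : ∀ i → weight w′ i ≐ f′ i) where

  ∣w-w′∣-value : ∀ i → ∣ weight w i - weight w′ i ∣ ≐ ℕ.∣ f i - f′ i ∣
  ∣w-w′∣-value i = ≐-∣-∣ {weight w i} {weight w′ i} (w≐f i) (w′≐f′ i)

  d-w-value : ∀ A A′ → d-w A w A′ w′ ≐ natDistance A f A′ f′
  d-w-value A A′ =
    ≐-+ {∑∈ (A ∩ A′) (λ i → ∣ weight w i - weight w′ i ∣) + ∑∈ (A ─ A′) (weight w)} {∑∈ (A′ ─ A) (weight w′)}
      (≐-+ {∑∈ (A ∩ A′) (λ i → ∣ weight w i - weight w′ i ∣)} {∑∈ (A ─ A′) (weight w)}
        (≐-∑∈ (A ∩ A′) ∣w-w′∣-value) (≐-∑∈ (A ─ A′) {weight w} {f} w≐f))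
      (≐-∑∈ (A′ ─ A) {weight w′} {f′} w′≐f′)

  norm-value : ‖ w - w′ ‖₁ ≐ sumℕ (λ i → ℕ.∣ f i - f′ i ∣)
  norm-value = ≐-sum ∣w-w′∣-value

*-congˡ : ∀ z {x y} → x ≋ y → z * x ≋ z * y
*-congˡ z {x} {y} e = *-cong {z} {z} {x} {y} ≋-refl e

expectation-natural : ∀ {n} (P : Distribution n) (g : Subset n → ℝ) {f : Subset n → ℕ} →
  (∀ A → g A ≐ f A) → expectation P g ≋ ∑⊆ (λ A → prob P A * ι (f A))
expectation-natural P g {f} e = 𝕊.∑⊆-cong {_} {λ A → prob P A * g A} {λ A → prob P A * ι (f A)}
  (λ A → *-congˡ (prob P A) {g A} {ι (f A)} (≐⇒≋ {g A} {f A} (e A)))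

expectedDistance-natural : ∀ {n} {P Q : Distribution n} (π : Coupling P Q) (w w′ : Weights n)
  {f : Subset n → Subset n → ℕ} → (∀ A A′ → d-w A w A′ w′ ≐ f A A′) →
  expectedDistance π w w′ ≋ ∑⊆ (λ A → ∑⊆ (λ A′ → joint π A A′ * ι (f A A′)))
expectedDistance-natural π w w′ {f} e = 𝕊.∑⊆-cong {_}
  {λ A → ∑⊆ (λ A′ → joint π A A′ * d-w A w A′ w′)} {λ A → ∑⊆ (λ A′ → joint π A A′ * ι (f A A′))}
  (λ A → 𝕊.∑⊆-cong {_} {λ A′ → joint π A A′ * d-w A w A′ w′} {λ A′ → joint π A A′ * ι (f A A′)}
    (λ A′ → *-congˡ (joint π A A′) {d-w A w A′ w′} {ι (f A A′)} (≐⇒≋ {d-w A w A′ w′} {f A A′} (e A A′))))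

satisfies? : ∀ {n} (A : Subset n) (Φ : Formula n) → Dec (Satisfies A Φ)
satisfies? A = all? (any? (λ (x , b) → lookup A x ≟ᵇ b))

-- W is a parameter, as concrete weights would unfold to normalised fractions.
module Hardness (α : ℝ) (8α≋7 : ι 8 * α ≋ ι 7) (𝒜 : Algorithm) (approx : IsApproximation α 𝒜)
  {n k B D : ℕ} {{k≢0 : ℕ.NonZero k}} {{B≢0 : ℕ.NonZero B}} (I : HardInstance n k B D)
  (W : Subset k → Weights n) (W-value : ∀ x i → weight (W x) i ≐ wt I x i) where

  norm : ∀ x j → ‖ W x - W (x [ j ]%= not) ‖₁ ≋ ι (2 ℕ.* B)
  norm x j = subst (λ m → ‖ W x - W (x [ j ]%= not) ‖₁ ≋ ι m) (wt-flip-sum I x j)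
    (≐⇒≋ {‖ W x - W (x [ j ]%= not) ‖₁} {sumℕ (λ i → ℕ.∣ wt I x i - wt I (x [ j ]%= not) i ∣)}
      (norm-value (W x) (W (x [ j ]%= not)) (W-value x) (W-value (x [ j ]%= not))))

  -- Equal weights would make the ℓ₁ distance 2B vanish. The Lipschitz condition speaks only of
  -- distinct weights, so this has to be excluded.
  W-flip : ∀ x j → ¬ (W x ≈ᵂ W (x [ j ]%= not))
  W-flip x j e = ℕ.≢-nonZero⁻¹ (2 ℕ.* B) {{ℕP.m*n≢0 2 B}}
    (≡.trans (≡.sym (wt-flip-sum I x j)) (sumℕ-zero λ i → ℕP.m≡n⇒∣m-n∣≡0 (wt-equal i)))
    where
    wt-equal : ∀ i → wt I x i ≡ wt I (x [ j ]%= not) i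
    wt-equal i = ι-injective {wt I x i} {wt I (x [ j ]%= not) i}
      (≋-trans {ι (wt I x i)} {weight (W x) i} {ι (wt I (x [ j ]%= not) i)}
        (≋-sym {weight (W x) i} {ι (wt I x i)} (≐⇒≋ {weight (W x) i} {wt I x i} (W-value x i)))
        (≋-trans {weight (W x) i} {weight (W (x [ j ]%= not)) i} {ι (wt I (x [ j ]%= not) i)}
          (wrap≈ {weight (W x) i} {weight (W (x [ j ]%= not)) i} (e i))
          (≐⇒≋ {weight (W (x [ j ]%= not)) i} {wt I (x [ j ]%= not) i} (W-value (x [ j ]%= not) i))))

  satisfiable : Satisfiable (Φ I)
  satisfiable = best I (Vec.replicate k false) , best-satisfies I (Vec.replicate k false)

  totalWeight-ι : ∀ x A → totalWeight (W x) A ≋ ι (natWeight (wt I x) A)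
  totalWeight-ι x A = ≐⇒≋ {totalWeight (W x) A} {natWeight (wt I x) A}
    (totalWeight-value (W x) (W-value x) A)

  optimum : ∀ x → IsOptimum (Φ I) (W x) (ι (2 ℕ.* (k ℕ.* B)))
  optimum x =
    (best I x , best-satisfies I x , unwrap≈ {totalWeight (W x) (best I x)} {ι (2 ℕ.* (k ℕ.* B))}
      (subst (λ m → totalWeight (W x) (best I x) ≋ ι m) (best-weight I x) (totalWeight-ι x (best I x)))) ,
    λ A h → unwrap (≼-trans {totalWeight (W x) A} {ι (natWeight (wt I x) A)} {ι (2 ℕ.* (k ℕ.* B))}
      (_≋_.to (totalWeight-ι x A))
      (ι-mono {natWeight (wt I x) A} {2 ℕ.* (k ℕ.* B)} (weight-≤ I x A h)))

  module _ (K : ℝ) (lip : IsLipschitzBound 𝒜 (Φ I) K) where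

    approximate : ∀ x → α * ι (2 ℕ.* (k ℕ.* B)) ≼
      ∑⊆ (λ A → prob (run 𝒜 (Φ I) (W x)) A * ι (natWeight (wt I x) A))
    approximate x = ≼-trans
      {α * ι (2 ℕ.* (k ℕ.* B))} {expectation (run 𝒜 (Φ I) (W x)) (totalWeight (W x))}
      {∑⊆ (λ A → prob (run 𝒜 (Φ I) (W x)) A * ι (natWeight (wt I x) A))}
      (wrap (proj₂ (approx (Φ I) satisfiable (W x)) (ι (2 ℕ.* (k ℕ.* B))) (optimum x)))
      (_≋_.to (expectation-natural (run 𝒜 (Φ I) (W x)) (totalWeight (W x))
        {natWeight (wt I x)} (totalWeight-value (W x) (W-value x))))

    -- Recasts the Lipschitz condition in the shape that `lipschitz-bound` takes: couplings as bare
    -- functions, distances and the norm as naturals.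
    EM-bound : ∀ x j l →
      (∀ (π : Subset n → Subset n → ℝ) → (∀ A A′ → 0ℝ ≼ π A A′) →
        (∀ A → ∑⊆ (λ A′ → π A A′) ≋ prob (run 𝒜 (Φ I) (W x)) A) →
        (∀ A′ → ∑⊆ (λ A → π A A′) ≋ prob (run 𝒜 (Φ I) (W (x [ j ]%= not))) A′) →
        l ≼ ∑⊆ (λ A → ∑⊆ (λ A′ → π A A′ * ι (natDistance A (wt I x) A′ (wt I (x [ j ]%= not)))))) →
      l ≼ K * ι (2 ℕ.* B)
    EM-bound x j l h = ≼-trans {l} {K * ‖ W x - W (x [ j ]%= not) ‖₁} {K * ι (2 ℕ.* B)}
      (wrap (lip (W x) (W (x [ j ]%= not)) (W-flip x j) l lower))
      (_≋_.to (*-congˡ K {‖ W x - W (x [ j ]%= not) ‖₁} {ι (2 ℕ.* B)} (norm x j)))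
      where
      lower : (π : Coupling (run 𝒜 (Φ I) (W x)) (run 𝒜 (Φ I) (W (x [ j ]%= not)))) →
        l ≤ expectedDistance π (W x) (W (x [ j ]%= not))
      lower π = unwrap (≼-trans
        {l} {∑⊆ (λ A → ∑⊆ (λ A′ → joint π A A′ * ι (natDistance A (wt I x) A′ (wt I (x [ j ]%= not)))))}
        {expectedDistance π (W x) (W (x [ j ]%= not))}
        (h (joint π) (λ A A′ → wrap (joint≥0 π A A′))
          (λ A → wrap≈ (marginalˡ π A)) (λ A′ → wrap≈ (marginalʳ π A′)))
        (_≋_.from (expectedDistance-natural π (W x) (W (x [ j ]%= not))
          {λ A A′ → natDistance A (wt I x) A′ (wt I (x [ j ]%= not))}
          (d-w-value (W x) (W (x [ j ]%= not)) (W-value x) (W-value (x [ j ]%= not))))))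

    bound : ∀ {c ρ} → ι 4 * c ≋ 1ℝ → ι B * ρ ≼ ι D → c * ρ ≼ K
    bound {c} {ρ} 4c≋1 ρ≼ = 𝕊.lipschitz-bound {n} {k} {D} {B} {{k≢0}} {{B≢0}} {α} {c} {ρ} {K}
      (λ x → prob (run 𝒜 (Φ I) (W x)))
      (λ x A → wrap (prob≥0 (run 𝒜 (Φ I) (W x)) A)) (λ x → wrap≈ (prob-sum (run 𝒜 (Φ I) (W x))))
      (λ A → Satisfies A (Φ I)) (λ A → satisfies? A (Φ I))
      (λ x A ¬f → wrap≈ (proj₁ (approx (Φ I) satisfiable (W x)) A ¬f))
      (agreement I) (λ x → natWeight (wt I x))
      (weight-agreement I)
      approximate (λ x j A A′ → natDistance A (wt I x) A′ (wt I (x [ j ]%= not))) (separated I)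
      EM-bound 8α≋7 4c≋1 ρ≼

-- Number of variables and choice of parameters

size : ℕ → ℕ
size t = Gadget.n t 0

size-+ : ∀ t r → size t ℕ.+ r ≡ Gadget.n t r
size-+ t r = regroup (3 ℕ.^ t) (2 ℕ.^ t) r
  where
  regroup : ∀ a b r → a ℕ.+ (a ℕ.+ (b ℕ.+ (b ℕ.+ 0))) ℕ.+ r ≡ a ℕ.+ (a ℕ.+ (b ℕ.+ (b ℕ.+ r)))
  regroup = ℕSolver.solve-∀

size-< : ∀ t → size t ℕ.< size (suc t)
size-< t = ℕP.+-mono-<-≤ 3^t< (ℕP.+-mono-≤ (ℕP.<⇒≤ 3^t<) (ℕP.+-mono-≤ 2^t≤ (ℕP.+-monoˡ-≤ 0 2^t≤)))
  where
  3^t< : 3 ℕ.^ t ℕ.< 3 ℕ.^ suc t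
  3^t< = ℕP.^-monoʳ-< 3 (ℕ.s≤s (ℕ.s≤s ℕ.z≤n)) (ℕP.n<1+n t)
  2^t≤ : 2 ℕ.^ t ℕ.≤ 2 ℕ.^ suc t
  2^t≤ = ℕP.^-monoʳ-≤ 2 (ℕP.n≤1+n t)

-- Sizes start at `size 0` = 4 and increase strictly, so induction on n moves to the next t exactly
-- when its size is reached.
size-bracket : ∀ n → 4 ℕ.≤ n → ∃[ t ] (size t ℕ.≤ n × n ℕ.< size (suc t))
size-bracket (suc n) 4≤1+n with 4 ℕP.≤? n
... | no 4≰n = 0 , 4≤1+n , ℕP.≤-trans (ℕ.s≤s (ℕP.≰⇒> 4≰n)) (ℕP.m≤m+n 5 5)
... | yes 4≤n with size-bracket n 4≤n
...   | t , lo , hi with suc n ℕP.<? size (suc t)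
...     | yes 1+n< = t , ℕP.m≤n⇒m≤1+n lo , 1+n<
...     | no  1+n≮ = suc t , ℕP.≮⇒≥ 1+n≮ , ℕP.<-≤-trans (ℕ.s≤s hi) (size-< (suc t))

-- The coefficient 4 is rounded up to 10 so that the total is 16 = 2^4, the fourth power of the
-- factor 2 in D.
size-suc-≤ : ∀ t → size (suc t) ℕ.≤ 16 ℕ.* 3 ℕ.^ t
size-suc-≤ t = begin
  size (suc t)                            ≡⟨ expand (3 ℕ.^ t) (2 ℕ.^ t) ⟩
  6 ℕ.* 3 ℕ.^ t ℕ.+ 4 ℕ.* 2 ℕ.^ t         ≤⟨ ℕP.+-monoʳ-≤ (6 ℕ.* 3 ℕ.^ t) (ℕP.*-mono-≤ {4} {10} (ℕP.m≤m+n 4 6)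
                                               (ℕP.^-monoˡ-≤ t (ℕP.n≤1+n 2))) ⟩
  6 ℕ.* 3 ℕ.^ t ℕ.+ 10 ℕ.* 3 ℕ.^ t        ≡⟨ ℕP.*-distribʳ-+ (3 ℕ.^ t) 6 10 ⟨
  16 ℕ.* 3 ℕ.^ t                          ∎
  where
  open ℕP.≤-Reasoning
  expand : ∀ a b → 3 ℕ.* a ℕ.+ (3 ℕ.* a ℕ.+ (2 ℕ.* b ℕ.+ (2 ℕ.* b ℕ.+ 0))) ≡ 6 ℕ.* a ℕ.+ 4 ℕ.* b
  expand = ℕSolver.solve-∀

-- 3⁵ = 243 ≤ 256 = 2⁸ is what makes the exponent 1/4 work.
n*B⁴≤D⁴ : ∀ t {n} → n ℕ.≤ 16 ℕ.* 3 ℕ.^ t → n ℕ.* (3 ℕ.^ t) ℕ.^ 4 ℕ.≤ (2 ℕ.* (2 ℕ.^ t ℕ.* 2 ℕ.^ t)) ℕ.^ 4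
n*B⁴≤D⁴ t {n} n≤ = begin
  n ℕ.* B ℕ.^ 4                 ≤⟨ ℕP.*-monoˡ-≤ (B ℕ.^ 4) n≤ ⟩
  16 ℕ.* B ℕ.* B ℕ.^ 4          ≡⟨ ℕP.*-assoc 16 B (B ℕ.^ 4) ⟩
  16 ℕ.* B ℕ.^ 5                ≡⟨ cong (16 ℕ.*_) (^-swap 3 5) ⟩
  16 ℕ.* 243 ℕ.^ t              ≤⟨ ℕP.*-monoʳ-≤ 16 (ℕP.^-monoˡ-≤ t (ℕP.m≤m+n 243 13)) ⟩
  16 ℕ.* 256 ℕ.^ t              ≡⟨ cong (16 ℕ.*_) (^-swap 2 8) ⟨
  16 ℕ.* k ℕ.^ 8                ≡⟨ cong (16 ℕ.*_) (ℕP.^-distribˡ-+-* k 4 4) ⟩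
  16 ℕ.* (k ℕ.^ 4 ℕ.* k ℕ.^ 4)  ≡⟨ cong (16 ℕ.*_) (^-distribʳ-* 4 k k) ⟨
  16 ℕ.* (k ℕ.* k) ℕ.^ 4        ≡⟨ ^-distribʳ-* 4 2 (k ℕ.* k) ⟨
  (2 ℕ.* (k ℕ.* k)) ℕ.^ 4       ∎
  where
  open ℕP.≤-Reasoning
  B k : ℕ
  B = 3 ℕ.^ t
  k = 2 ℕ.^ t
  ^-swap : ∀ a e → (a ℕ.^ t) ℕ.^ e ≡ (a ℕ.^ e) ℕ.^ t
  ^-swap a e = ≡.trans (ℕP.^-*-assoc a t e) (≡.trans (cong (a ℕ.^_) (ℕP.*-comm t e)) (≡.sym (ℕP.^-*-assoc a e t)))

natWeights : ∀ {n} → (Fin n → ℕ) → Weights n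
natWeights f = record { weight = λ i → ι (f i) ; nonNeg = λ i → unwrap (0≼ι (f i)) }

-- The term `root 4 (n ℕ.^ 1)` is what `n ^ δ` computes to at δ = 1/4. The numerical hypothesis is
-- the fourth power of n^(1/4) * B ≤ D.
hard-formula : ∀ {α} → ι 8 * α ≋ ι 7 → ∀ {c} → ι 4 * c ≋ 1ℝ →
  (𝒜 : Algorithm) → IsApproximation α 𝒜 → ∀ {n k B D} {{_ : ℕ.NonZero k}} {{_ : ℕ.NonZero B}} →
  HardInstance n k B D → n ℕ.* B ℕ.^ 4 ℕ.≤ D ℕ.^ 4 →
  ∃[ Φ ] (Satisfiable {n} Φ × LipschitzConstant≥ 𝒜 Φ (c * root 4 (n ℕ.^ 1)))
hard-formula {α} 8α≋7 {c} 4c≋1 𝒜 approx {n} {k} {B} {D} I h =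
  Φ I , H.satisfiable , λ K lip → unwrap (H.bound K lip {c} {root 4 (n ℕ.^ 1)} 4c≋1
    (ι*root-≼ 4 {n ℕ.^ 1} {D} B (subst (λ m → m ℕ.* B ℕ.^ 4 ℕ.≤ D ℕ.^ 4) (≡.sym (ℕP.^-identityʳ n)) h)))
  where
  module H = Hardness α 8α≋7 𝒜 approx I (λ x → natWeights (wt I x)) (λ x i → value λ _ → ≡.refl)

ε c : ℝ
ε = fromℚ (+ 1 ℚ./ 8)
c = fromℚ (+ 1 ℚ./ 4)

δ : ℚ
δ = + 1 ℚ./ 4

mainTheorem5 : ∃[ ε ] ∃[ δ ] (0ℝ < ε × 0ℚ ℚ.< δ ×
    ((𝒜 : Algorithm) → IsApproximation (1ℝ - ε) 𝒜 →
      ∃[ c ] (0ℝ < c × ∃[ n₀ ] ((n : ℕ) → n₀ ℕ.≤ n →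
        ∃[ Φ ] (Satisfiable {n} Φ × LipschitzConstant≥ 𝒜 Φ (c * n ^ δ))))))
mainTheorem5 = ε , δ , positive 7 , ℚP.positive⁻¹ δ , λ 𝒜 approx →
  -- The threshold 4 is `size 0`; from there on, n lies between two consecutive sizes and the excess
  -- over the smaller one becomes padding.
  c , positive 3 , 4 , λ n 4≤n →
    let t , lo , hi = size-bracket n 4≤n
        r , size+r≡n = ℕP.m≤n⇒∃[o]m+o≡n lo
        n≡ = ≡.trans (≡.sym (size-+ t r)) size+r≡n
    in hard-formula {1ℝ - ε} (pointwise {ι 8 * (1ℝ - ε)} {ι 7} (λ _ → ≡.refl))
      {c} (pointwise {ι 4 * c} {1ℝ} (λ _ → ≡.refl)) 𝒜 approx {{ℕP.m^n≢0 2 t}} {{ℕP.m^n≢0 3 t}}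
      (subst (λ n → HardInstance n (2 ℕ.^ t) (3 ℕ.^ t) (2 ℕ.* (2 ℕ.^ t ℕ.* 2 ℕ.^ t))) n≡ (Gadget.hardInstance t r))
      (n*B⁴≤D⁴ t (ℕP.≤-trans (ℕP.<⇒≤ hi) (size-suc-≤ t)))
  where
  positive : ∀ m → 0ℝ < fromℚ (+ 1 ℚ./ suc m)
  positive m = + 1 ℚ./ suc m , ℚP.positive⁻¹ (+ 1 ℚ./ suc m) {{ℚP.normalize-pos 1 (suc m)}} , 0 ,
    λ n _ → ℚP.≤-reflexive (ℚP.+-identityˡ (+ 1 ℚ./ suc m))
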